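{- Let $n\ge 1$. For a permutation $w\in\mathfrak{S}_n$ and $1\le k\le n$, let $\mathrm{noninv}_k(w)$ be the number of $k$-element subsets $\{i_1<\cdots<i_k\}\subseteq\{1,\dots,n\}$ such that $w(i_1)<w(i_2)<\cdots<w(i_k)$. Let $\nu_{(k,1^{n-k})}$ be the $n!\times n!$ integer matrix with rows and columns indexed by $\mathfrak{S}_n$ whose $(u,v)$-entry is $\mathrm{noninv}_k(v^{ -1}u)$ (equivalently, the operator of right multiplication on the group algebra $\mathbb{Z}\mathfrak{S}_n$ by the element $\sum_{w\in\mathfrak{S}_n}\mathrm{noninv}_k(w)\,w$). Then for all $k,\ell\in\{1,\dots,n\}$ one has $\nu_{(k,1^{n-k})}\,\nu_{(\ell,1^{n-\ell})}=\nu_{(\ell,1^{n-\ell})}\,\nu_{(k,1^{n-k})}$. -}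

module Defs where

open import Data.Nat using (ℕ; zero; suc)
open import Data.Bool using (Bool; true; false)
open import Data.Fin using (Fin; _<_; _<?_)
open import Data.Fin.Subset using (Subset; _∈_; ∣_∣)
open import Data.Fin.Subset.Properties using (_∈?_)
open import Data.Fin.Permutation using (Permutation′; _⟨$⟩ʳ_; _∘ₚ_; flip; insert; id)
open import Data.List using (List; []; _∷_; map; concatMap; sum; filter; length)
open import Data.List.Relation.Unary.All using (All)
open import Data.Vec using (Vec; []; _∷_)
import Data.Vec as Vec
open import Data.Integer using (ℤ; +_; _*_)
import Data.Integer as ℤ
open import Relation.Nullary using (Dec; yes; no; ¬_)
open import Relation.Nullary.Decidable using (_→-dec_; ⌊_⌋)
open import Relation.Binary.PropositionalEquality using (_≡_)
open import Data.Nat.Properties using (_≟_)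
open import Data.Product using (_×_)

allSubsets : ∀ n → List (Subset n)
allSubsets zero    = [] ∷ []
allSubsets (suc n) = map (false ∷_) (allSubsets n) Data.List.++ map (true ∷_) (allSubsets n)

elems : ∀ {n} → Subset n → List (Fin n)
elems {n} s = filter (λ i → i ∈? s) (Vec.toList (Vec.allFin n))

IncreasingOn : ∀ {n} → Permutation′ n → Subset n → Set
IncreasingOn {n} w s =
  All (λ i → All (λ j → i < j → (w ⟨$⟩ʳ i) < (w ⟨$⟩ʳ j)) (elems s)) (elems s)

increasingOn? : ∀ {n} (w : Permutation′ n) (s : Subset n) → Dec (IncreasingOn w s)
increasingOn? w s =
  Data.List.Relation.Unary.All.all? (λ i →
    Data.List.Relation.Unary.All.all? (λ j → (i <? j) →-dec ((w ⟨$⟩ʳ i) <? (w ⟨$⟩ʳ j))) (elems s)) (elems s)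

noninv : ∀ {n} → ℕ → Permutation′ n → ℕ
noninv {n} k w =
  length (filter (λ s → (∣ s ∣ ≟ k) Relation.Nullary.Decidable.×-dec increasingOn? w s) (allSubsets n))

-- All permutations of Fin n: every permutation of Fin (suc n) is uniquely
-- `insert 0 j π` (0 ↦ j, then π on the rest) for j : Fin (suc n), π ∈ S_n.
allPerms : ∀ n → List (Permutation′ n)
allPerms zero    = id ∷ []
allPerms (suc n) =
  concatMap (λ j → map (insert Fin.zero j) (allPerms n)) (Vec.toList (Vec.allFin (suc n)))
  where import Data.Fin as Fin

sumPerms : ∀ n → (Permutation′ n → ℤ) → ℤ
sumPerms n f = Data.List.foldr ℤ._+_ (+ 0) (map f (allPerms n))

PermMatrix : ℕ → Set
PermMatrix n = Permutation′ n → Permutation′ n → ℤ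

_⊗_ : ∀ {n} → PermMatrix n → PermMatrix n → PermMatrix n
_⊗_ {n} A B u v = sumPerms n (λ w → A u w * B w v)

-- Convention: (v⁻¹ u)(i) = v⁻¹(u(i)); in stdlib, (π ∘ₚ ρ) ⟨$⟩ʳ i = ρ ⟨$⟩ʳ (π ⟨$⟩ʳ i).
-- ν_{(k,1^{n-k})} : (u,v)-entry is noninv_k(v⁻¹ u).
ν : ∀ n → ℕ → PermMatrix n
ν n k u v = + noninv k (u ∘ₚ flip v)

{-# OPTIONS --safe #-}

-- Let insertion operators ins a and deletion operators del b act on integer-valued functions on
-- words, and put T (suc j) = Σ_b del b ∘ T j ∘ ins b. On words without repeated letters T (n - k) is
-- (n - k)! times ν_(k,1^(n-k)), since noninv_k(v⁻¹u) counts the common subwords of length k of the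
-- words of u and v. The commutators of ins and del are the letter
-- replacements rep, which form a copy of gl_n commuting with every T j, and one finds that
-- ins a ∘ T k = W k ∘ ins, where W k is polynomial in T k, T (k - 1) and the replacements.
-- Suppose the T j commute on words of length m. Then the operators W commute there, so the
-- commutator C of T k and T l on words of length m + 1 is killed by all ins a, and hence by every
-- T j with j ≥ 1. As T is self-adjoint, ⟨ C f , C f ⟩ = 0, and therefore C = 0.

module Submission where

open import Defs
open import Algebra using (CommutativeRing)
open import Data.Bool using (if_then_else_; true; false)
open import Data.Fin using (Fin; zero; suc; punchIn)
import Data.Fin as Fin
open import Data.Fin.Permutation using (Permutation′; _⟨$⟩ʳ_; _⟨$⟩ˡ_; inverseˡ; inverseʳ; insert; _∘ₚ_; flip)
open import Data.Fin.Properties using (_≟_; _<?_; <-irrefl; <-trans; <-cmp; <⇒≢; toℕ<n)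
open import Data.Fin.Subset using (Subset; ∣_∣)
open import Data.Fin.Subset.Properties using (_∈?_)
open import Data.Integer using (ℤ; +_; -_; -[1+_]; _+_; _-_; _*_; 0ℤ; 1ℤ; +≤+)
import Data.Integer as ℤ
open import Data.Integer.Properties using
  ( +-*-commutativeRing; *-zeroˡ; *-zeroʳ; *-identityˡ; *-comm; *-distribˡ-+; *-cancelˡ-≡; pos-*
  ; +-identityʳ; +-identityˡ; +-assoc; +-comm; +-mono-≤; ≤-refl; i*j≡0⇒i≡0∨j≡0)
open import Data.Integer.Tactic.RingSolver using (solve-∀)
open import Data.List using (List; []; _∷_; length; map; _++_; concatMap; foldr; filter; tabulate)
open import Data.List.Properties using (map-tabulate; map-∘; map-id; map-cong; length-tabulate)
open import Data.List.Relation.Binary.Permutation.Propositional using (_↭_; ↭-refl; ↭-sym; ↭-trans; prep; swap; ↭⇒↭ₛ)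
open import Data.List.Relation.Binary.Permutation.Propositional.Properties using (↭-length; All-resp-↭)
import Data.List.Relation.Binary.Permutation.Setoid.Properties as ↭ₛ
open import Data.List.Relation.Unary.All as All using (All; []; _∷_; all?)
import Data.List.Relation.Unary.All.Properties as Allₚ
open import Data.List.Relation.Unary.AllPairs as AllPairs using (AllPairs; []; _∷_; allPairs?)
import Data.List.Relation.Unary.AllPairs.Properties as AllPairsₚ
open import Data.List.Relation.Unary.Unique.Propositional using (Unique)
import Data.List.Relation.Unary.Unique.Propositional.Properties as Uniqueₚ
open import Data.Nat using (ℕ; zero; suc; _≤_; _!; z≤n; z<s; s<s; s<s⁻¹)
import Data.Nat as ℕ
open import Data.Nat.Properties using (_!*_!≢0)
import Data.Nat.Properties as ℕₚ
open import Data.Product using (_,_; uncurry)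
open import Data.Sum using (reduce)
open import Data.Vec using (toList)
import Data.Vec as Vec
open import Function using (_∘_; mk⇔)
open import Relation.Binary.Definitions using (Tri; tri<; tri≈; tri>)
open import Relation.Binary.PropositionalEquality
  using (_≡_; _≢_; _≗_; refl; sym; trans; cong; cong₂; subst; setoid; module ≡-Reasoning)
open import Relation.Nullary using (Dec; yes; no; does; ¬_; contradiction)
open import Relation.Nullary.Decidable using (_×-dec_; dec-true; dec-false; does-⇔)
open import Algebra.Properties.Semiring.Sum (CommutativeRing.semiring +-*-commutativeRing)
  using (sum; sum-cong-≗; ∑-distrib-+; ∑-comm; ∑-permute; *-distribˡ-sum; *-distribʳ-sum; sum-replicate-zero; sum-remove)

private
  variable
    n : ℕ

-- Insertion, deletion and replacement operators

χ : ∀ {p} {P : Set p} → Dec P → ℤ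
χ d = if does d then 1ℤ else 0ℤ

δ : Fin n → Fin n → ℤ
δ x y = χ (x ≟ y)

Word : ℕ → Set
Word n = List (Fin n)

Fun : ℕ → Set
Fun n = Word n → ℤ

len : Word n → ℤ
len w = + length w

-- Operators act on functions by summing over modified argument words, so in a composite the
-- outermost operator modifies the word first.
ins del : Fin n → Fun n → Fun n
ins a f []      = f (a ∷ [])
ins a f (x ∷ w) = f (a ∷ x ∷ w) + ins a (f ∘ (x ∷_)) w

del b f []      = 0ℤ
del b f (x ∷ w) = δ x b * f w + del b (f ∘ (x ∷_)) w

rep : Fin n → Fin n → Fun n → Fun n
rep c a f []      = 0ℤ
rep c a f (x ∷ w) = δ x c * f (a ∷ w) + rep c a (f ∘ (x ∷_)) w

-- Up to normalisation this is `k`-random-to-random shuffling: `k` letters are deleted one after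
-- another, then reinserted at arbitrary places.
T : ℕ → Fun n → Fun n
T zero    f   = f
T (suc k) f w = sum λ b → del b (T k (ins b f)) w

record Linear (P : Fun n → Fun n) : Set where
  field
    resp  : ∀ {f g} → f ≗ g → P f ≗ P g
    add   : ∀ f g → P (λ w → f w + g w) ≗ λ w → P f w + P g w
    scale : ∀ c f → P (λ w → c * f w) ≗ λ w → c * P f w

  null : P (λ _ → 0ℤ) ≗ λ _ → 0ℤ
  -- Multiplication by `0ℤ` computes to `0ℤ` on both sides, so no rewriting is left.
  null w = scale 0ℤ (λ _ → 0ℤ) w

  sums : ∀ {m} (f : Fin m → Fun n) → P (λ w → sum λ i → f i w) ≗ λ w → sum λ i → P (f i) w
  sums {zero}  f w = null w
  sums {suc m} f w = trans (add _ _ w) (cong (_+_ (P (f zero) w)) (sums (f ∘ suc) w))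

  lincomb : ∀ c f g → P (λ w → c * f w + g w) ≗ λ w → c * P f w + P g w
  lincomb c f g w = trans (add _ _ w) (cong (_+ P g w) (scale c f w))

open Linear

sum-zero : ∀ {m} {f : Fin m → ℤ} → (∀ i → f i ≡ 0ℤ) → sum f ≡ 0ℤ
sum-zero {m} h = trans (sum-cong-≗ h) (sum-replicate-zero m)

sum-δ : ∀ {m} (a : Fin m) (f : Fin m → ℤ) → sum (λ b → δ a b * f b) ≡ f a
sum-δ {suc m} zero    f = trans (cong₂ _+_ (*-identityˡ (f zero)) (sum-zero λ i → *-zeroˡ (f (suc i)))) (+-identityʳ (f zero))
sum-δ {suc m} (suc a) f = trans (+-identityˡ _) (sum-δ a (f ∘ suc))

δ-sym : (x y : Fin n) → δ x y ≡ δ y x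
δ-sym x y with x ≟ y | y ≟ x
... | yes _ | yes _ = refl
... | no _  | no _  = refl
... | yes p | no q  = contradiction (sym p) q
... | no p  | yes q = contradiction (sym q) p

sum-δ′ : ∀ {m} (a : Fin m) (f : Fin m → ℤ) → sum (λ b → δ b a * f b) ≡ f a
sum-δ′ a f = trans (sum-cong-≗ λ b → cong (_* f b) (δ-sym b a)) (sum-δ a f)

-- Linearity of the operators

ins-resp : (a : Fin n) → ∀ {f g} → f ≗ g → ins a f ≗ ins a g
ins-resp a h []      = h _
ins-resp a h (x ∷ w) = cong₂ _+_ (h _) (ins-resp a (λ v → h (x ∷ v)) w)

ins-add : (a : Fin n) → ∀ f g → ins a (λ w → f w + g w) ≗ λ w → ins a f w + ins a g w
ins-add a f g []      = refl
ins-add a f g (x ∷ w) = trans (cong (_+_ (f (a ∷ x ∷ w) + g (a ∷ x ∷ w))) (ins-add a _ _ w)) (lemma (f _) (g _) _ _)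
  where
  lemma : ∀ p q r s → p + q + (r + s) ≡ p + r + (q + s)
  lemma = solve-∀

ins-scale : (a : Fin n) → ∀ k f → ins a (λ w → k * f w) ≗ λ w → k * ins a f w
ins-scale a c f []      = refl
ins-scale a c f (x ∷ w) = trans (cong (_+_ (c * f (a ∷ x ∷ w))) (ins-scale a c _ w)) (lemma c (f _) _)
  where
  lemma : ∀ c p q → c * p + c * q ≡ c * (p + q)
  lemma = solve-∀

ins-linear : (a : Fin n) → Linear (ins a)
ins-linear a = record { resp = ins-resp a ; add = ins-add a ; scale = ins-scale a }

del-resp : (b : Fin n) → ∀ {f g} → f ≗ g → del b f ≗ del b g
del-resp b h []      = refl
del-resp b h (x ∷ w) = cong₂ _+_ (cong (δ x b *_) (h w)) (del-resp b (λ v → h (x ∷ v)) w)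

del-add : (b : Fin n) → ∀ f g → del b (λ w → f w + g w) ≗ λ w → del b f w + del b g w
del-add b f g []      = refl
del-add b f g (x ∷ w) = trans (cong (_+_ (δ x b * (f w + g w))) (del-add b _ _ w)) (lemma (δ x b) (f _) (g _) _ _)
  where
  lemma : ∀ d p q r s → d * (p + q) + (r + s) ≡ d * p + r + (d * q + s)
  lemma = solve-∀

del-scale : (b : Fin n) → ∀ k f → del b (λ w → k * f w) ≗ λ w → k * del b f w
del-scale b c f []      = sym (*-zeroʳ c)
del-scale b c f (x ∷ w) = trans (cong (_+_ (δ x b * (c * f w))) (del-scale b c _ w)) (lemma c (δ x b) (f _) _)
  where
  lemma : ∀ c d p q → d * (c * p) + c * q ≡ c * (d * p + q)
  lemma = solve-∀

del-linear : (b : Fin n) → Linear (del b)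
del-linear b = record { resp = del-resp b ; add = del-add b ; scale = del-scale b }

rep-resp : (c a : Fin n) → ∀ {f g} → f ≗ g → rep c a f ≗ rep c a g
rep-resp c a h []      = refl
rep-resp c a h (x ∷ w) = cong₂ _+_ (cong (δ x c *_) (h _)) (rep-resp c a (λ v → h (x ∷ v)) w)

rep-add : (c a : Fin n) → ∀ f g → rep c a (λ w → f w + g w) ≗ λ w → rep c a f w + rep c a g w
rep-add c a f g []      = refl
rep-add c a f g (x ∷ w) = trans (cong (_+_ (δ x c * (f (a ∷ w) + g (a ∷ w)))) (rep-add c a _ _ w)) (lemma (δ x c) (f _) (g _) _ _)
  where
  lemma : ∀ d p q r s → d * (p + q) + (r + s) ≡ d * p + r + (d * q + s)
  lemma = solve-∀

rep-scale : (c a : Fin n) → ∀ k f → rep c a (λ w → k * f w) ≗ λ w → k * rep c a f w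
rep-scale c a e f []      = sym (*-zeroʳ e)
rep-scale c a e f (x ∷ w) = trans (cong (_+_ (δ x c * (e * f (a ∷ w)))) (rep-scale c a e _ w)) (lemma e (δ x c) (f _) _)
  where
  lemma : ∀ c d p q → d * (c * p) + c * q ≡ c * (d * p + q)
  lemma = solve-∀

rep-linear : (c a : Fin n) → Linear (rep c a)
rep-linear c a = record { resp = rep-resp c a ; add = rep-add c a ; scale = rep-scale c a }

T-linear : ∀ k → Linear (T {n} k)
T-linear zero    .resp h w    = h w
T-linear zero    .add f g w   = refl
T-linear zero    .scale c f w = refl
T-linear (suc k) .resp h w    = sum-cong-≗ λ b → resp (del-linear b) (resp (T-linear k) (resp (ins-linear b) h)) w
T-linear (suc k) .add f g w   = trans
  (sum-cong-≗ λ b → trans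
    (resp (del-linear b) (λ v → trans (resp (T-linear k) (add (ins-linear b) f g) v) (add (T-linear k) _ _ v)) w)
    (add (del-linear b) _ _ w))
  (∑-distrib-+ (λ b → del b (T k (ins b f)) w) (λ b → del b (T k (ins b g)) w))
T-linear (suc k) .scale c f w = trans
  (sum-cong-≗ λ b → trans
    (resp (del-linear b) (λ v → trans (resp (T-linear k) (scale (ins-linear b) c f) v) (scale (T-linear k) c _ v)) w)
    (scale (del-linear b) c _ w))
  (sym (*-distribˡ-sum c (λ b → del b (T k (ins b f)) w)))

-- Commutation relations

ins-ins : ∀ (a b : Fin n) f → ins a (ins b f) ≗ ins b (ins a f)
ins-ins a b f [] = lemma (f _) (f _)
  where
  lemma : ∀ p q → p + q ≡ q + p
  lemma = solve-∀
ins-ins a b f (x ∷ w)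
  rewrite add (ins-linear a) (λ v → f (b ∷ x ∷ v)) (ins b (f ∘ (x ∷_))) w
        | add (ins-linear b) (λ v → f (a ∷ x ∷ v)) (ins a (f ∘ (x ∷_))) w
        | ins-ins a b (f ∘ (x ∷_)) w
        = lemma (f _) (f _) _ _ _
  where
  lemma : ∀ p q r s t → p + (q + r) + (s + t) ≡ q + (p + s) + (r + t)
  lemma = solve-∀

-- On words, `a` is inserted and then a `b` is deleted. If an old `b` goes, the two slots beside it
-- merge, and the surplus slot amounts to replacing that `b` by `a`. If the new letter itself goes,
-- then `a` equals `b`, and this happens once for each of the `len w + 1ℤ` slots.
ins-del : ∀ (a b : Fin n) f w →
  ins a (del b f) w ≡ del b (ins a f) w + (rep b a f w + δ a b * ((len w + 1ℤ) * f w))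
ins-del a b f [] = lemma (δ a b) (f [])
  where
  lemma : ∀ d p → d * p + 0ℤ ≡ 0ℤ + (0ℤ + d * (1ℤ * p))
  lemma = solve-∀
ins-del a b f (x ∷ w)
  rewrite lincomb (ins-linear a) (δ x b) f (del b (f ∘ (x ∷_))) w
        | add (del-linear b) (λ v → f (a ∷ x ∷ v)) (ins a (f ∘ (x ∷_))) w
        | ins-del a b (f ∘ (x ∷_)) w
        = lemma (δ a b) (δ x b) (f (x ∷ w)) (f (a ∷ w)) _ _ _ _ (len w)
  where
  lemma : ∀ d e p q r s t u l →
    d * p + (e * q + r) + (e * s + (t + (u + d * ((l + 1ℤ) * p)))) ≡
    e * s + (r + t) + (e * q + u + d * ((1ℤ + l + 1ℤ) * p))
  lemma = solve-∀

-- The two orders differ only where the deleted letter is the `a` just created, which amounts to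
-- deleting a `c`.
del-rep : ∀ (b c a : Fin n) f w →
  del b (rep c a f) w ≡ rep c a (del b f) w - δ a b * del c f w
del-rep b c a f [] = lemma (δ a b)
  where
  lemma : ∀ d → 0ℤ ≡ 0ℤ - d * 0ℤ
  lemma = solve-∀
del-rep b c a f (x ∷ w)
  rewrite lincomb (del-linear b) (δ x c) (λ v → f (a ∷ v)) (rep c a (f ∘ (x ∷_))) w
        | lincomb (rep-linear c a) (δ x b) f (del b (f ∘ (x ∷_))) w
        | del-rep b c a (f ∘ (x ∷_)) w
        = lemma (δ a b) (δ x b) (δ x c) (f w) _ _ _ _
  where
  lemma : ∀ d e g p q r s t →
    e * q + (g * r + (s - d * t)) ≡ g * (d * p + r) + (e * q + s) - d * (g * p + t)
  lemma = solve-∀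

-- The two orders differ only where the letter replaced is the one just inserted.
ins-rep : ∀ (b c a : Fin n) f w →
  ins b (rep c a f) w ≡ rep c a (ins b f) w + δ b c * ins a f w
ins-rep b c a f [] = lemma (δ b c) (f _)
  where
  lemma : ∀ d p → d * p + 0ℤ ≡ 0ℤ + d * p
  lemma = solve-∀
ins-rep b c a f (x ∷ w)
  rewrite lincomb (ins-linear b) (δ x c) (λ v → f (a ∷ v)) (rep c a (f ∘ (x ∷_))) w
        | add (rep-linear c a) (λ v → f (b ∷ x ∷ v)) (ins b (f ∘ (x ∷_))) w
        | ins-rep b c a (f ∘ (x ∷_)) w
        = lemma (δ b c) (δ x c) (f (a ∷ x ∷ w)) (f (b ∷ a ∷ w)) _ _ _ _
  where
  lemma : ∀ d e p q r s t u →
    d * p + (e * q + r) + (e * s + (t + d * u)) ≡ e * (q + s) + (r + t) + d * (p + u)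
  lemma = solve-∀

del-len : ∀ (b : Fin n) e f w →
  del b (λ v → (len v + e) * f v) w ≡ (len w + e - 1ℤ) * del b f w
del-len b e f [] = sym (*-zeroʳ (0ℤ + e - 1ℤ))
del-len b e f (x ∷ w) = trans
  (cong (_+_ (δ x b * ((len w + e) * f w))) (trans
    (resp (del-linear b) (λ v → shift (len v) e (f (x ∷ v))) w)
    (del-len b (1ℤ + e) (f ∘ (x ∷_)) w)))
  (lemma (δ x b) (len w) e (f w) _)
  where
  shift : ∀ l e p → (1ℤ + l + e) * p ≡ (l + (1ℤ + e)) * p
  shift = solve-∀
  lemma : ∀ d l e p q → d * ((l + e) * p) + (l + (1ℤ + e) - 1ℤ) * q ≡ (1ℤ + l + e - 1ℤ) * (d * p + q)
  lemma = solve-∀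

sum-sub : ∀ {m} (f g : Fin m → ℤ) → sum (λ i → f i - g i) ≡ sum f - sum g
sum-sub {zero}  f g = refl
sum-sub {suc m} f g = trans (cong (_+_ (f zero - g zero)) (sum-sub (f ∘ suc) (g ∘ suc))) (lemma (f zero) (g zero) _ _)
  where
  lemma : ∀ p q r s → p - q + (r - s) ≡ p + r - (q + s)
  lemma = solve-∀

del-rep-sum : ∀ (c a : Fin n) (g : Fin n → Fun n) w →
  sum (λ b → del b (rep c a (g b)) w) ≡ rep c a (λ v → sum λ b → del b (g b) v) w - del c (g a) w
del-rep-sum c a g w = begin
  sum (λ b → del b (rep c a (g b)) w)
    ≡⟨ sum-cong-≗ (λ b → del-rep b c a (g b) w) ⟩
  sum (λ b → rep c a (del b (g b)) w - δ a b * del c (g b) w)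
    ≡⟨ sum-sub (λ b → rep c a (del b (g b)) w) _ ⟩
  sum (λ b → rep c a (del b (g b)) w) - sum (λ b → δ a b * del c (g b) w)
    ≡⟨ cong₂ _-_ (sym (sums (rep-linear c a) (λ b → del b (g b)) w)) (sum-δ a (λ b → del c (g b) w)) ⟩
  rep c a (λ v → sum λ b → del b (g b) v) w - del c (g a) w ∎
  where open ≡-Reasoning

-- Moving `rep c a` past `ins b` leaves an error only at `b = c`, and past `del b` only at `b = a`.
-- Both errors are `del c (T k (ins a f))`, with opposite signs: the sum over `b` of the pairs
-- `del b`, `ins b` is invariant under gl_n.
T-rep : ∀ k (c a : Fin n) f → T k (rep c a f) ≗ rep c a (T k f)
T-rep zero    c a f w = refl
T-rep (suc k) c a f w = begin
  sum (λ b → del b (T k (ins b (rep c a f))) w)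
    ≡⟨ sum-cong-≗ (λ b → del-resp b (expand b) w) ⟩
  sum (λ b → del b (λ v → δ b c * T k (ins a f) v + rep c a (T k (ins b f)) v) w)
    ≡⟨ sum-cong-≗ (λ b → lincomb (del-linear b) (δ b c) (T k (ins a f)) _ w) ⟩
  sum (λ b → δ b c * del b (T k (ins a f)) w + del b (rep c a (T k (ins b f))) w)
    ≡⟨ ∑-distrib-+ (λ b → δ b c * del b (T k (ins a f)) w) _ ⟩
  sum (λ b → δ b c * del b (T k (ins a f)) w) + sum (λ b → del b (rep c a (T k (ins b f))) w)
    ≡⟨ cong₂ _+_ (sum-δ′ c (λ b → del b (T k (ins a f)) w)) (del-rep-sum c a (λ b → T k (ins b f)) w) ⟩
  del c (T k (ins a f)) w + (rep c a (T (suc k) f) w - del c (T k (ins a f)) w)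
    ≡⟨ cancel (del c (T k (ins a f)) w) _ ⟩
  rep c a (T (suc k) f) w ∎
  where
  open ≡-Reasoning
  cancel : ∀ p q → p + (q - p) ≡ q
  cancel = solve-∀
  expand : ∀ b v → T k (ins b (rep c a f)) v ≡ δ b c * T k (ins a f) v + rep c a (T k (ins b f)) v
  expand b v = begin
    T k (ins b (rep c a f)) v
      ≡⟨ resp (T-linear k) (λ u → trans (ins-rep b c a f u) (+-comm (rep c a (ins b f) u) _)) v ⟩
    T k (λ u → δ b c * ins a f u + rep c a (ins b f) u) v
      ≡⟨ lincomb (T-linear k) (δ b c) (ins a f) _ v ⟩
    δ b c * T k (ins a f) v + T k (rep c a (ins b f)) v
      ≡⟨ cong (_+_ (δ b c * T k (ins a f) v)) (T-rep k c a (ins b f) v) ⟩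
    δ b c * T k (ins a f) v + rep c a (T k (ins b f)) v ∎

-- Intertwining of `ins` with `T`

-- The ℤ-linear action on families h = (h c) through which ins intertwines T (suc k).
W : ℕ → (Fin n → Fun n) → Fin n → Fun n
W k h a w = T (suc k) (h a) w +
  + suc k * (sum (λ c → rep c a (T k (h c)) w) + (len w + (1ℤ - + k)) * T k (h a) w)

-- This and `del-ins-T` go by mutual induction: passing the outer `del b` costs one commutator
-- `ins-del`, and what remains, an `ins a` between `del b` and `T k`, is `del-ins-T` at `k`, which
-- rests on `ins-T` at `k - 1`.
ins-T : ∀ k (a : Fin n) f → ins a (T (suc k) f) ≗ W k (λ c → ins c f) a
del-ins-T : ∀ k (a : Fin n) f w →
  sum (λ b → del b (ins a (T k (ins b f))) w) ≡
  T (suc k) (ins a f) w +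
  + k * (sum (λ c → rep c a (T k (ins c f)) w) + (len w - + k) * T k (ins a f) w)

ins-T k a f w = begin
  ins a (λ v → sum λ b → del b (g b) v) w
    ≡⟨ sums (ins-linear a) (λ b → del b (g b)) w ⟩
  sum (λ b → ins a (del b (g b)) w)
    ≡⟨ sum-cong-≗ (λ b → ins-del a b (g b) w) ⟩
  sum (λ b → del b (ins a (g b)) w + (rep b a (g b) w + δ a b * ((len w + 1ℤ) * g b w)))
    ≡⟨ ∑-distrib-+ (λ b → del b (ins a (g b)) w) _ ⟩
  sum (λ b → del b (ins a (g b)) w) + sum (λ b → rep b a (g b) w + δ a b * ((len w + 1ℤ) * g b w))
    ≡⟨ cong (_+_ (sum (λ b → del b (ins a (g b)) w))) (∑-distrib-+ (λ b → rep b a (g b) w) _) ⟩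
  sum (λ b → del b (ins a (g b)) w) +
    (sum (λ b → rep b a (g b) w) + sum (λ b → δ a b * ((len w + 1ℤ) * g b w)))
    ≡⟨ cong₂ (λ x y → x + (sum (λ b → rep b a (g b) w) + y)) (del-ins-T k a f w) (sum-δ a λ b → (len w + 1ℤ) * g b w) ⟩
  T (suc k) (ins a f) w + + k * (sum (λ c → rep c a (g c) w) + (len w - + k) * g a w) +
    (sum (λ b → rep b a (g b) w) + (len w + 1ℤ) * g a w)
    -- The length terms fit because k(l - k) + (l + 1) = (k + 1)(l + 1 - k).
    ≡⟨ collect (T (suc k) (ins a f) w) (+ k) (len w) (sum λ c → rep c a (g c) w) (g a w) ⟩
  W k (λ c → ins c f) a w ∎
  where
  open ≡-Reasoning
  g : Fin _ → Fun _
  g b = T k (ins b f)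
  collect : ∀ t k l r p → t + k * (r + (l - k) * p) + (r + (l + 1ℤ) * p) ≡
    t + (1ℤ + k) * (r + (l + (1ℤ - k)) * p)
  collect = solve-∀

del-ins-T zero    a f w = trans (sum-cong-≗ (λ b → del-resp b (ins-ins a b f) w)) (lemma _ (sum (λ c → rep c a (ins c f) w) + (len w - 0ℤ) * ins a f w))
  where
  lemma : ∀ t x → t ≡ t + 0ℤ * x
  lemma = solve-∀
del-ins-T (suc k) a f w = begin
  sum (λ b → del b (ins a (T (suc k) (ins b f))) w)
    ≡⟨ sum-cong-≗ step ⟩
  sum (λ b → del b (T (suc k) (ins b (ins a f))) w + + suc k * (r b + s b))
    ≡⟨ ∑-distrib-+ (λ b → del b (T (suc k) (ins b (ins a f))) w) _ ⟩
  t₂ + sum (λ b → + suc k * (r b + s b))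
    ≡⟨ cong (_+_ t₂) (sym (*-distribˡ-sum (+ suc k) λ b → r b + s b)) ⟩
  t₂ + + suc k * sum (λ b → r b + s b)
    ≡⟨ cong (λ x → t₂ + + suc k * x) (∑-distrib-+ r s) ⟩
  t₂ + + suc k * (sum r + sum s)
    ≡⟨ cong₂ (λ x y → t₂ + + suc k * (x + y)) reps (sym (*-distribˡ-sum (len w - + k) λ b → del b (T k (ins b (ins a f))) w)) ⟩
  t₂ + + suc k * ((r′ - t₁) + (len w - + k) * t₁)
    ≡⟨ collect t₂ t₁ (+ k) (len w) r′ ⟩
  t₂ + + suc k * (r′ + (len w - + suc k) * t₁) ∎
  where
  open ≡-Reasoning
  t₁ t₂ r′ : ℤ
  t₁ = T (suc k) (ins a f) w
  t₂ = T (suc (suc k)) (ins a f) w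
  r′ = sum (λ c → rep c a (T (suc k) (ins c f)) w)
  r s : Fin _ → ℤ
  r b = sum (λ c → del b (rep c a (T k (ins c (ins b f)))) w)
  s b = (len w - + k) * del b (T k (ins b (ins a f))) w
  collect : ∀ t₂ t₁ k l r → t₂ + (1ℤ + k) * ((r - t₁) + (l - k) * t₁) ≡
    t₂ + (1ℤ + k) * (r + (l - (1ℤ + k)) * t₁)
  collect = solve-∀
  -- For each `c`, `del-rep-sum` leaves behind one `del c` term. Once the two insertions are
  -- exchanged, these terms add up to `T (suc k) (ins a f)`.
  reps : sum r ≡ r′ - t₁
  reps = begin
    sum r
      ≡⟨ ∑-comm (λ b c → del b (rep c a (T k (ins c (ins b f)))) w) ⟩
    sum (λ c → sum λ b → del b (rep c a (T k (ins c (ins b f)))) w)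
      ≡⟨ sum-cong-≗ (λ c → trans
           (sum-cong-≗ λ b → del-resp b (rep-resp c a (resp (T-linear k) (ins-ins c b f))) w)
           (del-rep-sum c a (λ b → T k (ins b (ins c f))) w)) ⟩
    sum (λ c → rep c a (T (suc k) (ins c f)) w - del c (T k (ins a (ins c f))) w)
      ≡⟨ sum-sub (λ c → rep c a (T (suc k) (ins c f)) w) _ ⟩
    r′ - sum (λ c → del c (T k (ins a (ins c f))) w)
      ≡⟨ cong (_-_ r′) (sum-cong-≗ λ c → del-resp c (resp (T-linear k) (ins-ins a c f)) w) ⟩
    r′ - t₁ ∎
  step : ∀ b → del b (ins a (T (suc k) (ins b f))) w ≡
    del b (T (suc k) (ins b (ins a f))) w + + suc k * (r b + s b)
  step b = begin
    del b (ins a (T (suc k) (ins b f))) w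
      ≡⟨ del-resp b (λ v → trans (ins-T k a (ins b f) v) (cong (_+ + suc k * (R v + L v)) (resp (T-linear (suc k)) (ins-ins a b f) v))) w ⟩
    del b (λ v → T (suc k) (ins b (ins a f)) v + + suc k * (R v + L v)) w
      ≡⟨ del-add b (T (suc k) (ins b (ins a f))) _ w ⟩
    D + del b (λ v → + suc k * (R v + L v)) w
      ≡⟨ cong (_+_ D) (del-scale b (+ suc k) (λ v → R v + L v) w) ⟩
    D + + suc k * del b (λ v → R v + L v) w
      ≡⟨ cong (λ x → D + + suc k * x) (del-add b R L w) ⟩
    D + + suc k * (del b R w + del b L w)
      ≡⟨ cong₂ (λ x y → D + + suc k * (x + y))
           (sums (del-linear b) (λ c → rep c a (T k (ins c (ins b f)))) w)
           (trans (del-len b (1ℤ - + k) (T k (ins a (ins b f))) w)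
             (cong₂ _*_ (shift (len w) (+ k)) (del-resp b (resp (T-linear k) (ins-ins a b f)) w))) ⟩
    D + + suc k * (r b + s b) ∎
    where
    R L : Fun _
    R v = sum λ c → rep c a (T k (ins c (ins b f))) v
    L v = (len v + (1ℤ - + k)) * T k (ins a (ins b f)) v
    D : ℤ
    D = del b (T (suc k) (ins b (ins a f))) w
    shift : ∀ l k → l + (1ℤ - k) - 1ℤ ≡ l - k
    shift = solve-∀

-- Locality of the operators

data Removal {A : Set} (x : A) : List A → List A → Set where
  here  : ∀ {w} → Removal x (x ∷ w) w
  there : ∀ {y w v} → Removal x w v → Removal x (y ∷ w) (y ∷ v)

removal-↭ : ∀ {A : Set} {x : A} {w v} → Removal x w v → w ↭ x ∷ v
removal-↭ here      = ↭-refl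
removal-↭ (there r) = ↭-trans (prep _ (removal-↭ r)) (swap _ _ ↭-refl)

ins-cong : ∀ (a : Fin n) {f g w} → (∀ {v} → Removal a v w → f v ≡ g v) → ins a f w ≡ ins a g w
ins-cong a {w = []}    h = h here
ins-cong a {w = x ∷ w} h = cong₂ _+_ (h here) (ins-cong a (λ r → h (there r)))

del-cong : ∀ (b : Fin n) {f g w} → (∀ {v} → Removal b w v → f v ≡ g v) → del b f w ≡ del b g w
del-cong b {w = []}    h = refl
del-cong b {w = x ∷ w} h with x ≟ b
... | yes refl = cong₂ _+_ (cong (1ℤ *_) (h here)) (del-cong b (λ r → h (there r)))
... | no _     = cong (_+_ 0ℤ) (del-cong b (λ r → h (there r)))

rep-cong : ∀ (c a : Fin n) {f g} w → (∀ v → length v ≡ length w → f v ≡ g v) → rep c a f w ≡ rep c a g w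
rep-cong c a []      h = refl
rep-cong c a (x ∷ w) h = cong₂ _+_ (cong (δ x c *_) (h _ refl)) (rep-cong c a w λ v e → h _ (cong suc e))

-- Every letter deleted by `T k` is put back, so only rearrangements of `w` are ever evaluated.
T-cong : ∀ k {f g : Fun n} {w} → (∀ {v} → v ↭ w → f v ≡ g v) → T k f w ≡ T k g w
T-cong zero    h = h ↭-refl
T-cong (suc k) h = sum-cong-≗ λ b → del-cong b λ r → T-cong k λ p → ins-cong b λ s →
  h (↭-trans (removal-↭ s) (↭-trans (prep b p) (↭-sym (removal-↭ r))))

LengthLocal : (Fun n → Fun n) → Set
LengthLocal P = ∀ {f g} w → (∀ v → length v ≡ length w → f v ≡ g v) → P f w ≡ P g w

T-local : ∀ k → LengthLocal (T {n} k)
T-local k w h = T-cong k λ p → h _ (↭-length p)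

-- Commutation of the operators `W`

-- The factor `len v + e` varies with `v`, but `P` sees only words as long as `w`, so it can be
-- frozen at `len w` and pulled out as a scalar.
expand : ∀ {P : Fun n → Fun n} → Linear P → LengthLocal P → ∀ {m} k e X (R : Fin m → Fun n) Y w →
  P (λ v → X v + k * (sum (λ d → R d v) + (len v + e) * Y v)) w ≡
  P X w + k * (sum (λ d → P (R d) w) + (len w + e) * P Y w)
expand {P = P} lin loc k e X R Y w = begin
  P (λ v → X v + k * (sum (λ d → R d v) + (len v + e) * Y v)) w
    ≡⟨ loc w (λ v eq → cong (λ l → X v + k * (sum (λ d → R d v) + (+ l + e) * Y v)) eq) ⟩
  P (λ v → X v + k * (sum (λ d → R d v) + (len w + e) * Y v)) w
    ≡⟨ add lin X _ w ⟩
  P X w + P (λ v → k * (sum (λ d → R d v) + (len w + e) * Y v)) w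
    ≡⟨ cong (_+_ (P X w)) (scale lin k (λ v → sum (λ d → R d v) + (len w + e) * Y v) w) ⟩
  P X w + k * P (λ v → sum (λ d → R d v) + (len w + e) * Y v) w
    ≡⟨ cong (λ x → P X w + k * x) (add lin (λ v → sum (λ d → R d v)) _ w) ⟩
  P X w + k * (P (λ v → sum (λ d → R d v)) w + P (λ v → (len w + e) * Y v) w)
    ≡⟨ cong₂ (λ x y → P X w + k * (x + y)) (sums lin R w) (scale lin (len w + e) Y w) ⟩
  P X w + k * (sum (λ d → P (R d) w) + (len w + e) * P Y w) ∎
  where open ≡-Reasoning

T-W : ∀ i l (h : Fin n → Fun n) a w → T i (W l h a) w ≡ T i (T (suc l) (h a)) w +
  + suc l * (sum (λ d → rep d a (T i (T l (h d))) w) + (len w + (1ℤ - + l)) * T i (T l (h a)) w)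
T-W i l h a w = trans
  (expand (T-linear i) (T-local i) (+ suc l) (1ℤ - + l) (T (suc l) (h a)) (λ d → rep d a (T l (h d))) (T l (h a)) w)
  (cong (λ x → T i (T (suc l) (h a)) w + + suc l * (x + (len w + (1ℤ - + l)) * T i (T l (h a)) w))
    (sum-cong-≗ λ d → T-rep i d a (T l (h d)) w))

module Expansion (h : Fin n → Fun n) (a : Fin n) (w : Word n) where
  -- The terms of `W k (W l h)` with no, one and two replacements. By `T-rep` all replacements stand
  -- outside, so the indices enter only through the products `T i (T j _)`.
  P Q R : ℕ → ℕ → ℤ
  P i j = T i (T j (h a)) w
  Q i j = sum λ c → rep c a (T i (T j (h c))) w
  R i j = sum λ c → sum λ d → rep c a (rep d c (T i (T j (h d)))) w

  β : ℕ → ℤ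
  β k = len w + (1ℤ - + k)

  expandSum : ∀ k l → sum (λ c → rep c a (T k (W l h c)) w) ≡
    Q k (suc l) + + suc l * (R k l + β l * Q k l)
  expandSum k l = begin
    sum (λ c → rep c a (T k (W l h c)) w)
      ≡⟨ sum-cong-≗ (λ c → trans (rep-resp c a (T-W k l h c) w)
           (expand (rep-linear c a) (rep-cong c a) (+ suc l) (1ℤ - + l) (T k (T (suc l) (h c)))
             (λ d → rep d c (T k (T l (h d)))) (T k (T l (h c))) w)) ⟩
    sum (λ c → q′ c + + suc l * (r c + β l * q c))
      ≡⟨ ∑-distrib-+ q′ _ ⟩
    Q k (suc l) + sum (λ c → + suc l * (r c + β l * q c))
      ≡⟨ cong (_+_ (Q k (suc l))) (sym (*-distribˡ-sum (+ suc l) λ c → r c + β l * q c)) ⟩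
    Q k (suc l) + + suc l * sum (λ c → r c + β l * q c)
      ≡⟨ cong (λ x → Q k (suc l) + + suc l * x) (∑-distrib-+ r _) ⟩
    Q k (suc l) + + suc l * (R k l + sum (λ c → β l * q c))
      ≡⟨ cong (λ x → Q k (suc l) + + suc l * (R k l + x)) (sym (*-distribˡ-sum (β l) q)) ⟩
    Q k (suc l) + + suc l * (R k l + β l * Q k l) ∎
    where
    open ≡-Reasoning
    q′ r q : Fin n → ℤ
    q′ c = rep c a (T k (T (suc l) (h c))) w
    r c = sum λ d → rep c a (rep d c (T k (T l (h d)))) w
    q c = rep c a (T k (T l (h c))) w

  expandW : ∀ k l → W k (W l h) a w ≡
    P (suc k) (suc l) + + suc l * (Q (suc k) l + β l * P (suc k) l) +
    + suc k * (Q k (suc l) + + suc l * (R k l + β l * Q k l) +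
               β k * (P k (suc l) + + suc l * (Q k l + β l * P k l)))
  expandW k l = cong₂ (λ x y → x + + suc k * y) (T-W (suc k) l h a w)
    (cong₂ (λ x y → x + β k * y) (expandSum k l) (T-W k l h a w))

CommuteAt : ℕ → ℕ → Set
CommuteAt n m = ∀ k l (f : Fun n) w → length w ≡ m → T k (T l f) w ≡ T l (T k f) w

-- Replacements preserve length, so the hypothesis at length `m` makes `P`, `Q` and `R` symmetric in
-- their indices. The expansion is then symmetric under exchanging `k` and `l`.
W-comm : ∀ {m} → CommuteAt n m → ∀ k l h a w → length w ≡ m → W k (W l h) a w ≡ W l (W k h) a w
W-comm comm k l h a w eq = begin
  W k (W l h) a w
    ≡⟨ expandW k l ⟩
  P (suc k) (suc l) + + suc l * (Q (suc k) l + β l * P (suc k) l) +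
    + suc k * (Q k (suc l) + + suc l * (R k l + β l * Q k l) +
               β k * (P k (suc l) + + suc l * (Q k l + β l * P k l)))
    ≡⟨ lemma (+ suc k) (+ suc l) (β k) (β l) (P (suc k) (suc l)) (Q (suc k) l) (P (suc k) l) (Q k (suc l)) (R k l) (Q k l) (P k (suc l)) (P k l) ⟩
  P (suc k) (suc l) + + suc k * (Q k (suc l) + β k * P k (suc l)) +
    + suc l * (Q (suc k) l + + suc k * (R k l + β k * Q k l) +
               β l * (P (suc k) l + + suc k * (Q k l + β k * P k l)))
    ≡⟨ cong₂ _+_
         (cong₂ (λ x y → x + + suc k * y) (P-comm (suc k) (suc l))
           (cong₂ (λ x y → x + β k * y) (Q-comm k (suc l)) (P-comm k (suc l))))
         (cong (+ suc l *_) (cong₂ _+_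
           (cong₂ (λ x y → x + + suc k * y) (Q-comm (suc k) l) (cong₂ (λ x y → x + β k * y) (R-comm k l) (Q-comm k l)))
           (cong (β l *_) (cong₂ (λ x y → x + + suc k * y) (P-comm (suc k) l)
             (cong₂ (λ x y → x + β k * y) (Q-comm k l) (P-comm k l)))))) ⟩
  P (suc l) (suc k) + + suc k * (Q (suc l) k + β k * P (suc l) k) +
    + suc l * (Q l (suc k) + + suc k * (R l k + β k * Q l k) +
               β l * (P l (suc k) + + suc k * (Q l k + β k * P l k)))
    ≡⟨ sym (expandW l k) ⟩
  W l (W k h) a w ∎
  where
  open ≡-Reasoning
  open Expansion h a w
  P-comm : ∀ i j → P i j ≡ P j i
  P-comm i j = comm i j (h a) w eq
  Q-comm : ∀ i j → Q i j ≡ Q j i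
  Q-comm i j = sum-cong-≗ λ c → rep-cong c a w λ v e → comm i j (h c) v (trans e eq)
  R-comm : ∀ i j → R i j ≡ R j i
  R-comm i j = sum-cong-≗ λ c → sum-cong-≗ λ d → rep-cong c a w λ v e →
    rep-cong d c v λ u e′ → comm i j (h d) u (trans e′ (trans e eq))
  lemma : ∀ k l bk bl p₁₁ q₁₀ p₁₀ q₀₁ r q p₀₁ p →
    p₁₁ + l * (q₁₀ + bl * p₁₀) + k * (q₀₁ + l * (r + bl * q) + bk * (p₀₁ + l * (q + bl * p))) ≡
    p₁₁ + k * (q₀₁ + bk * p₀₁) + l * (q₁₀ + k * (r + bk * q) + bl * (p₁₀ + k * (q + bk * p)))
  lemma = solve-∀

ins-TT : ∀ k l (a : Fin n) f → ins a (T (suc k) (T (suc l) f)) ≗ W k (W l (λ c → ins c f)) a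
ins-TT k l a f w = trans (ins-T k a (T (suc l) f) w) (cong₂ (λ x y → x + + suc k * y)
  (resp (T-linear (suc k)) (ins-T l a f) w)
  (cong₂ (λ x y → x + (len w + (1ℤ - + k)) * y)
    (sum-cong-≗ λ c → rep-resp c a (resp (T-linear k) (ins-T l c f)) w)
    (resp (T-linear k) (ins-T l a f) w)))

-- The inner product on words of fixed length, adjoints and definiteness

total : ℕ → Fun n → ℤ
total zero    f = f []
total (suc m) f = sum λ x → total m (f ∘ (x ∷_))

total-cong : ∀ m {f g : Fun n} → (∀ w → length w ≡ m → f w ≡ g w) → total m f ≡ total m g
total-cong zero    h = h [] refl
total-cong (suc m) h = sum-cong-≗ λ x → total-cong m λ w e → h (x ∷ w) (cong suc e)

total-zero : ∀ m {f : Fun n} → (∀ w → length w ≡ m → f w ≡ 0ℤ) → total m f ≡ 0ℤ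
total-zero zero    h = h [] refl
total-zero (suc m) h = sum-zero λ x → total-zero m λ w e → h (x ∷ w) (cong suc e)

total-add : ∀ m (f g : Fun n) → total m (λ w → f w + g w) ≡ total m f + total m g
total-add zero    f g = refl
total-add (suc m) f g = trans (sum-cong-≗ λ x → total-add m (f ∘ (x ∷_)) (g ∘ (x ∷_)))
  (∑-distrib-+ (λ x → total m (f ∘ (x ∷_))) _)

total-scale : ∀ m c (f : Fun n) → total m (λ w → c * f w) ≡ c * total m f
total-scale zero    c f = refl
total-scale (suc m) c f = trans (sum-cong-≗ λ x → total-scale m c (f ∘ (x ∷_)))
  (sym (*-distribˡ-sum c (λ x → total m (f ∘ (x ∷_)))))

total-sums : ∀ m {i} (f : Fin i → Fun n) → total m (λ w → sum λ j → f j w) ≡ sum λ j → total m (f j)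
total-sums zero    f = refl
total-sums (suc m) f = trans (sum-cong-≗ λ x → total-sums m (λ j → f j ∘ (x ∷_)))
  (∑-comm (λ x j → total m (f j ∘ (x ∷_))))

⟨_,_⟩ : Fun n → Fun n → ℕ → ℤ
⟨ f , g ⟩ m = total m λ w → f w * g w

⟨⟩-comm : ∀ m (f g : Fun n) → ⟨ f , g ⟩ m ≡ ⟨ g , f ⟩ m
⟨⟩-comm m f g = total-cong m λ w _ → *-comm (f w) (g w)

-- A word with a slot for `a` is the same as a longer word with a marked occurrence of `a`; both
-- sides sum over these pairs.
ins-adjoint : ∀ m (a : Fin n) f g → ⟨ ins a f , g ⟩ m ≡ ⟨ f , del a g ⟩ (suc m)
ins-adjoint {n} zero a f g = sym (trans
  (sum-cong-≗ λ x → lemma (f (x ∷ [])) (δ x a) (g []))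
  (sum-δ′ a λ x → f (x ∷ []) * g []))
  where
  lemma : ∀ p d q → p * (d * q + 0ℤ) ≡ d * (p * q)
  lemma = solve-∀
ins-adjoint {n} (suc m) a f g = begin
  sum (λ x → total m λ w → ins a f (x ∷ w) * g (x ∷ w))
    ≡⟨ sum-cong-≗ (λ x → trans
         (total-cong m λ w _ → distrib (f (a ∷ x ∷ w)) (ins a (f ∘ (x ∷_)) w) (g (x ∷ w)))
         (total-add m (λ w → f (a ∷ x ∷ w) * g (x ∷ w)) λ w → ins a (f ∘ (x ∷_)) w * g (x ∷ w))) ⟩
  sum (λ x → total m (λ w → f (a ∷ x ∷ w) * g (x ∷ w)) + ⟨ ins a (f ∘ (x ∷_)) , g ∘ (x ∷_) ⟩ m)
    ≡⟨ ∑-distrib-+ (λ x → total m (λ w → f (a ∷ x ∷ w) * g (x ∷ w))) _ ⟩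
  ⟨ f ∘ (a ∷_) , g ⟩ (suc m) + sum (λ x → ⟨ ins a (f ∘ (x ∷_)) , g ∘ (x ∷_) ⟩ m)
    ≡⟨ cong₂ _+_ (sym (sum-δ′ a λ x → ⟨ f ∘ (x ∷_) , g ⟩ (suc m))) (sum-cong-≗ λ x → ins-adjoint m a (f ∘ (x ∷_)) (g ∘ (x ∷_))) ⟩
  sum (λ x → δ x a * ⟨ f ∘ (x ∷_) , g ⟩ (suc m)) + sum (λ x → ⟨ f ∘ (x ∷_) , del a (g ∘ (x ∷_)) ⟩ (suc m))
    ≡⟨ sym (∑-distrib-+ (λ x → δ x a * ⟨ f ∘ (x ∷_) , g ⟩ (suc m)) _) ⟩
  sum (λ x → δ x a * ⟨ f ∘ (x ∷_) , g ⟩ (suc m) + ⟨ f ∘ (x ∷_) , del a (g ∘ (x ∷_)) ⟩ (suc m))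
    ≡⟨ sum-cong-≗ (λ x → sym (trans
         (total-cong (suc m) λ w _ → factor (f (x ∷ w)) (δ x a) (g w) (del a (g ∘ (x ∷_)) w))
         (trans (total-add (suc m) (λ w → δ x a * (f (x ∷ w) * g w)) λ w → f (x ∷ w) * del a (g ∘ (x ∷_)) w)
           (cong (_+ ⟨ f ∘ (x ∷_) , del a (g ∘ (x ∷_)) ⟩ (suc m)) (total-scale (suc m) (δ x a) λ w → f (x ∷ w) * g w))))) ⟩
  sum (λ x → total (suc m) λ w → f (x ∷ w) * del a g (x ∷ w)) ∎
  where
  open ≡-Reasoning
  distrib : ∀ p q r → (p + q) * r ≡ p * r + q * r
  distrib = solve-∀
  factor : ∀ p d q r → p * (d * q + r) ≡ d * (p * q) + p * r
  factor = solve-∀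

del-adjoint : ∀ m (a : Fin n) f g → ⟨ del a f , g ⟩ (suc m) ≡ ⟨ f , ins a g ⟩ m
del-adjoint m a f g = trans (⟨⟩-comm (suc m) (del a f) g)
  (trans (sym (ins-adjoint m a g f)) (⟨⟩-comm m (ins a g) f))

T-suc-[] : ∀ k (f : Fun n) → T (suc k) f [] ≡ 0ℤ
T-suc-[] {n} k f = sum-replicate-zero n

-- The definition of `T` is a palindrome once `ins` and `del` are exchanged as adjoints.
T-adjoint : ∀ m k (f g : Fun n) → ⟨ T k f , g ⟩ m ≡ ⟨ f , T k g ⟩ m
T-adjoint m zero f g = refl
T-adjoint zero (suc k) f g = trans (cong (_* g []) (T-suc-[] k f))
  (sym (trans (cong (f [] *_) (T-suc-[] k g)) (*-zeroʳ (f []))))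
T-adjoint (suc m) (suc k) f g = begin
  ⟨ T (suc k) f , g ⟩ (suc m)
    ≡⟨ total-cong (suc m) (λ w _ → *-distribʳ-sum (g w) (λ b → del b (T k (ins b f)) w)) ⟩
  total (suc m) (λ w → sum λ b → del b (T k (ins b f)) w * g w)
    ≡⟨ total-sums (suc m) (λ b w → del b (T k (ins b f)) w * g w) ⟩
  sum (λ b → ⟨ del b (T k (ins b f)) , g ⟩ (suc m))
    ≡⟨ sum-cong-≗ (λ b → trans (del-adjoint m b (T k (ins b f)) g)
         (trans (T-adjoint m k (ins b f) (ins b g)) (ins-adjoint m b f (T k (ins b g))))) ⟩
  sum (λ b → ⟨ f , del b (T k (ins b g)) ⟩ (suc m))
    ≡⟨ sym (total-sums (suc m) (λ b w → f w * del b (T k (ins b g)) w)) ⟩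
  total (suc m) (λ w → sum λ b → f w * del b (T k (ins b g)) w)
    ≡⟨ sym (total-cong (suc m) (λ w _ → *-distribˡ-sum (f w) (λ b → del b (T k (ins b g)) w))) ⟩
  ⟨ f , T (suc k) g ⟩ (suc m) ∎
  where open ≡-Reasoning

square-nonneg : ∀ i → 0ℤ ℤ.≤ i * i
square-nonneg (+ zero)   = +≤+ z≤n
square-nonneg (+ suc _)  = +≤+ z≤n
square-nonneg (-[1+ _ ]) = +≤+ z≤n

sum-nonneg : ∀ {m} {f : Fin m → ℤ} → (∀ i → 0ℤ ℤ.≤ f i) → 0ℤ ℤ.≤ sum f
sum-nonneg {zero}  h = ≤-refl
sum-nonneg {suc m} h = +-mono-≤ (h zero) (sum-nonneg (h ∘ suc))

total-nonneg : ∀ m {f : Fun n} → (∀ w → 0ℤ ℤ.≤ f w) → 0ℤ ℤ.≤ total m f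
total-nonneg zero    h = h []
total-nonneg (suc m) h = sum-nonneg λ x → total-nonneg m λ w → h (x ∷ w)

+-nonneg-zero : ∀ {i j} → 0ℤ ℤ.≤ i → 0ℤ ℤ.≤ j → i + j ≡ 0ℤ → i ≡ 0ℤ
+-nonneg-zero {+ zero}  {+ _} p q e = refl
+-nonneg-zero {+ suc _} {+ _} p q ()

sum-nonneg-zero : ∀ {m} {f : Fin m → ℤ} → (∀ i → 0ℤ ℤ.≤ f i) → sum f ≡ 0ℤ → ∀ i → f i ≡ 0ℤ
sum-nonneg-zero h e zero    = +-nonneg-zero (h zero) (sum-nonneg (h ∘ suc)) e
sum-nonneg-zero {f = f} h e (suc i) = sum-nonneg-zero (h ∘ suc)
  (+-nonneg-zero (sum-nonneg (h ∘ suc)) (h zero) (trans (+-comm _ (f zero)) e)) i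

total-nonneg-zero : ∀ m {f : Fun n} → (∀ w → 0ℤ ℤ.≤ f w) → total m f ≡ 0ℤ → ∀ w → length w ≡ m → f w ≡ 0ℤ
total-nonneg-zero zero    h e []      _  = e
total-nonneg-zero (suc m) h e (x ∷ w) eq = total-nonneg-zero m (λ v → h (x ∷ v))
  (sum-nonneg-zero (λ y → total-nonneg m λ v → h (y ∷ v)) e x) w (ℕₚ.suc-injective eq)

⟨⟩-definite : ∀ m (f : Fun n) → ⟨ f , f ⟩ m ≡ 0ℤ → ∀ w → length w ≡ m → f w ≡ 0ℤ
⟨⟩-definite m f e w eq = reduce (i*j≡0⇒i≡0∨j≡0 (f w) (total-nonneg-zero m (λ v → square-nonneg (f v)) e w eq))

-- Commutation of the operators `T`

T-comm : ∀ m → CommuteAt n m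
T-comm m       zero    l       f w  eq = refl
T-comm m       (suc k) zero    f w  eq = refl
T-comm zero    (suc k) (suc l) f [] eq = trans (T-suc-[] k (T (suc l) f)) (sym (T-suc-[] l (T (suc k) f)))
T-comm {n} (suc m) (suc k) (suc l) f w eq = begin
  T (suc k) (T (suc l) f) w
    ≡⟨ sym (restore (T (suc k) (T (suc l) f) w) (T (suc l) (T (suc k) f) w)) ⟩
  T (suc l) (T (suc k) f) w + C w
    ≡⟨ cong (_+_ (T (suc l) (T (suc k) f) w)) (⟨⟩-definite (suc m) C ⟨C,C⟩≡0 w eq) ⟩
  T (suc l) (T (suc k) f) w + 0ℤ
    ≡⟨ +-identityʳ _ ⟩
  T (suc l) (T (suc k) f) w ∎
  where
  open ≡-Reasoning
  restore : ∀ p q → q + (- 1ℤ * q + p) ≡ p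
  restore = solve-∀
  cancel : ∀ p → - 1ℤ * p + p ≡ 0ℤ
  cancel = solve-∀

  -- The commutator, with the difference put in the shape that `lincomb` takes.
  C : Fun n
  C v = - 1ℤ * T (suc l) (T (suc k) f) v + T (suc k) (T (suc l) f) v

  -- Intertwining turns this into a commutator of operators `W` on words of length `m`, where the
  -- induction hypothesis applies.
  ins-C : ∀ a v → length v ≡ m → ins a C v ≡ 0ℤ
  ins-C a v eq = begin
    ins a C v
      ≡⟨ lincomb (ins-linear a) (- 1ℤ) (T (suc l) (T (suc k) f)) _ v ⟩
    - 1ℤ * ins a (T (suc l) (T (suc k) f)) v + ins a (T (suc k) (T (suc l) f)) v
      ≡⟨ cong₂ (λ x y → - 1ℤ * x + y) (ins-TT l k a f v)
           (trans (ins-TT k l a f v) (W-comm (T-comm m) k l (λ c → ins c f) a v eq)) ⟩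
    - 1ℤ * W l (W k (λ c → ins c f)) a v + W l (W k (λ c → ins c f)) a v
      ≡⟨ cancel (W l (W k (λ c → ins c f)) a v) ⟩
    0ℤ ∎

  T-null : ∀ j {g : Fun n} v → (∀ u → length u ≡ length v → g u ≡ 0ℤ) → T j g v ≡ 0ℤ
  T-null j v h = trans (T-local j v h) (null (T-linear j) v)

  -- The first deletion shortens the word to length `m`, and `T j` keeps that length, so `ins b C`
  -- is evaluated only where `ins-C` kills it.
  T-C : ∀ j v → length v ≡ suc m → T (suc j) C v ≡ 0ℤ
  T-C j v eq = sum-zero λ b → trans
    (del-cong b {w = v} λ {u} r → T-null j u λ u′ e →
      ins-C b u′ (trans e (ℕₚ.suc-injective (trans (sym (↭-length (removal-↭ r))) eq))))
    (null (del-linear b) v)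

  TT-C : ∀ i j v → length v ≡ suc m → T i (T (suc j) C) v ≡ 0ℤ
  TT-C i j v eq = T-null i v λ u e → T-C j u (trans e eq)

  -- Adjointness carries both operators over to `C`, and the one that meets `C` directly has
  -- positive index.
  ⟨TT,C⟩≡0 : ∀ i j → ⟨ T (suc i) (T j f) , C ⟩ (suc m) ≡ 0ℤ
  ⟨TT,C⟩≡0 i j = begin
    ⟨ T (suc i) (T j f) , C ⟩ (suc m) ≡⟨ T-adjoint (suc m) (suc i) (T j f) C ⟩
    ⟨ T j f , T (suc i) C ⟩ (suc m)   ≡⟨ T-adjoint (suc m) j f (T (suc i) C) ⟩
    ⟨ f , T j (T (suc i) C) ⟩ (suc m) ≡⟨ total-zero (suc m) (λ v e → trans (cong (f v *_) (TT-C j i v e)) (*-zeroʳ (f v))) ⟩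
    0ℤ                                ∎

  ⟨C,C⟩≡0 : ⟨ C , C ⟩ (suc m) ≡ 0ℤ
  ⟨C,C⟩≡0 = begin
    ⟨ C , C ⟩ (suc m)
      ≡⟨ total-cong (suc m) (λ v _ → distrib (T (suc l) (T (suc k) f) v) (T (suc k) (T (suc l) f) v) (C v)) ⟩
    total (suc m) (λ v → - 1ℤ * (T (suc l) (T (suc k) f) v * C v) + T (suc k) (T (suc l) f) v * C v)
      ≡⟨ total-add (suc m) (λ v → - 1ℤ * (T (suc l) (T (suc k) f) v * C v)) (λ v → T (suc k) (T (suc l) f) v * C v) ⟩
    total (suc m) (λ v → - 1ℤ * (T (suc l) (T (suc k) f) v * C v)) + ⟨ T (suc k) (T (suc l) f) , C ⟩ (suc m)
      ≡⟨ cong₂ _+_ (trans (total-scale (suc m) (- 1ℤ) λ v → T (suc l) (T (suc k) f) v * C v)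
           (cong (- 1ℤ *_) (⟨TT,C⟩≡0 l (suc k)))) (⟨TT,C⟩≡0 k (suc l)) ⟩
    0ℤ ∎
    where
    distrib : ∀ p q r → (- 1ℤ * p + q) * r ≡ - 1ℤ * (p * r) + q * r
    distrib = solve-∀

-- Indicators of increasing words

χ-yes : ∀ {p} {P : Set p} (d : Dec P) → P → χ d ≡ 1ℤ
χ-yes d p = cong (λ b → if b then 1ℤ else 0ℤ) (dec-true d p)

χ-no : ∀ {p} {P : Set p} (d : Dec P) → ¬ P → χ d ≡ 0ℤ
χ-no d ¬p = cong (λ b → if b then 1ℤ else 0ℤ) (dec-false d ¬p)

χ-⇔ : ∀ {p q} {P : Set p} {Q : Set q} (d : Dec P) (e : Dec Q) → (P → Q) → (Q → P) → χ d ≡ χ e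
χ-⇔ d e f g = cong (λ b → if b then 1ℤ else 0ℤ) (does-⇔ (mk⇔ f g) d e)

χ-∧ : ∀ {p q} {P : Set p} {Q : Set q} (d : Dec P) (e : Dec Q) → χ (d ×-dec e) ≡ χ d * χ e
χ-∧ d e with does d
... | true  = sym (*-identityˡ (χ e))
... | false = refl

above : Fin n → Fun n
above x w = χ (all? (x <?_) w)

-- On words of length `n` this is the point mass at the identity word. Being defined at all lengths,
-- it can also be evaluated on subwords.
σ : Fun n
σ w = χ (allPairs? _<?_ w)

σ-∷ : ∀ (x : Fin n) w → σ (x ∷ w) ≡ above x w * σ w
σ-∷ x w = χ-∧ (all? (x <?_) w) (allPairs? _<?_ w)

ins-above : ∀ (a x : Fin n) f w →
  ins a (λ v → above x v * f v) w ≡ χ (x <? a) * (above x w * ins a f w)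
ins-above {n} a x f [] = trans (cong (_* f (a ∷ [])) (χ-∧ (x <? a) (all? (x <?_) ([] {A = Fin n}))))
  (lemma (χ (x <? a)) (f (a ∷ [])))
  where
  lemma : ∀ p q → p * 1ℤ * q ≡ p * (1ℤ * q)
  lemma = solve-∀
ins-above a x f (y ∷ w) = begin
  above x (a ∷ y ∷ w) * f (a ∷ y ∷ w) + ins a (λ v → above x (y ∷ v) * f (y ∷ v)) w
    ≡⟨ cong₂ (λ p q → p * f (a ∷ y ∷ w) + q) (χ-∧ (x <? a) (all? (x <?_) (y ∷ w)))
         (ins-resp a (λ v → trans (cong (_* f (y ∷ v)) (χ-∧ (x <? y) (all? (x <?_) v)))
           (assoc (χ (x <? y)) (above x v) (f (y ∷ v)))) w) ⟩
  χ (x <? a) * above x (y ∷ w) * f (a ∷ y ∷ w) + ins a (λ v → χ (x <? y) * (above x v * f (y ∷ v))) w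
    ≡⟨ cong₂ (λ p q → χ (x <? a) * p * f (a ∷ y ∷ w) + q) (χ-∧ (x <? y) (all? (x <?_) w))
         (trans (ins-scale a (χ (x <? y)) (λ v → above x v * f (y ∷ v)) w)
           (cong (χ (x <? y) *_) (ins-above a x (f ∘ (y ∷_)) w))) ⟩
  χ (x <? a) * (χ (x <? y) * above x w) * f (a ∷ y ∷ w) +
    χ (x <? y) * (χ (x <? a) * (above x w * ins a (f ∘ (y ∷_)) w))
    ≡⟨ factor (χ (x <? a)) (χ (x <? y)) (above x w) (f (a ∷ y ∷ w)) (ins a (f ∘ (y ∷_)) w) ⟩
  χ (x <? a) * (χ (x <? y) * above x w * ins a f (y ∷ w))
    ≡⟨ cong (λ p → χ (x <? a) * (p * ins a f (y ∷ w))) (sym (χ-∧ (x <? y) (all? (x <?_) w))) ⟩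
  χ (x <? a) * (above x (y ∷ w) * ins a f (y ∷ w)) ∎
  where
  open ≡-Reasoning
  assoc : ∀ p q r → p * q * r ≡ p * (q * r)
  assoc = solve-∀
  factor : ∀ p q r s t → p * (q * r) * s + q * (p * (r * t)) ≡ p * (q * r * (s + t))
  factor = solve-∀

-- A new letter fits into an increasing word at exactly one place, and no insertion makes a
-- non-increasing word increasing.
ins-σ : ∀ (a : Fin n) w → All (a ≢_) w → ins a σ w ≡ σ w
ins-σ a []      _            = refl
ins-σ a (x ∷ w) (a≢x ∷ a∉w) = begin
  σ (a ∷ x ∷ w) + ins a (λ v → σ (x ∷ v)) w
    ≡⟨ cong (_+_ (σ (a ∷ x ∷ w))) (trans (ins-resp a (σ-∷ x) w) (ins-above a x σ w)) ⟩
  σ (a ∷ x ∷ w) + χ (x <? a) * (above x w * ins a σ w)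
    ≡⟨ cong (λ p → σ (a ∷ x ∷ w) + χ (x <? a) * (above x w * p)) (ins-σ a w a∉w) ⟩
  σ (a ∷ x ∷ w) + χ (x <? a) * (above x w * σ w)
    ≡⟨ cong (λ p → σ (a ∷ x ∷ w) + χ (x <? a) * p) (sym (σ-∷ x w)) ⟩
  σ (a ∷ x ∷ w) + χ (x <? a) * σ (x ∷ w)
    ≡⟨ split (<-cmp a x) ⟩
  σ (x ∷ w) ∎
  where
  open ≡-Reasoning
  -- If `a` lies below the head `x`, only the front slot can succeed; if it lies above, only the
  -- later ones can.
  split : Tri (a Fin.< x) (a ≡ x) (x Fin.< a) → σ (a ∷ x ∷ w) + χ (x <? a) * σ (x ∷ w) ≡ σ (x ∷ w)
  split (tri< a<x _ x≮a) = trans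
    (cong₂ (λ p q → p + q * σ (x ∷ w))
      (χ-⇔ (allPairs? _<?_ (a ∷ x ∷ w)) (allPairs? _<?_ (x ∷ w)) AllPairs.tail
        λ { (x<w ∷ w↑) → (a<x ∷ All.map (<-trans a<x) x<w) ∷ x<w ∷ w↑ })
      (χ-no (x <? a) x≮a))
    (+-identityʳ _)
  split (tri≈ _ a≡x _)   = contradiction a≡x a≢x
  split (tri> a≮x _ x<a) = trans
    (cong₂ (λ p q → p + q * σ (x ∷ w))
      (χ-no (allPairs? _<?_ (a ∷ x ∷ w)) λ { ((a<x ∷ _) ∷ _) → a≮x a<x })
      (χ-yes (x <? a) x<a))
    (trans (+-identityˡ _) (*-identityˡ _))

-- Sums over subwords

subwordSum : ℕ → Fun n → Fun n
subwordSum zero    p w       = p []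
subwordSum (suc j) p []      = 0ℤ
subwordSum (suc j) p (x ∷ w) = subwordSum (suc j) p w + subwordSum j (p ∘ (x ∷_)) w

subwordSum-exceeding : ∀ j (p : Fun n) w → length w ℕ.< j → subwordSum j p w ≡ 0ℤ
subwordSum-exceeding (suc j) p []      _  = refl
subwordSum-exceeding (suc j) p (x ∷ w) lt = cong₂ _+_
  (subwordSum-exceeding (suc j) p w (ℕₚ.<-trans (ℕₚ.n<1+n _) lt)) (subwordSum-exceeding j (p ∘ (x ∷_)) w (s<s⁻¹ lt))

subwordSum-length : ∀ (p : Fun n) w → subwordSum (length w) p w ≡ p w
subwordSum-length p []      = refl
subwordSum-length p (x ∷ w) = trans
  (cong₂ _+_ (subwordSum-exceeding (suc (length w)) p w (ℕₚ.n<1+n _)) (subwordSum-length (p ∘ (x ∷_)) w)) (+-identityˡ _)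

sum-del-∷ : ∀ f (x : Fin n) w →
  sum (λ b → del b f (x ∷ w)) ≡ f w + sum (λ b → del b (f ∘ (x ∷_)) w)
sum-del-∷ f x w = trans (∑-distrib-+ (λ b → δ x b * f w) _)
  (cong (_+ sum (λ b → del b (f ∘ (x ∷_)) w)) (sum-δ x λ _ → f w))

-- A subword of length j survives the deletion of exactly those len w - j letters it omits.
sum-del-subwordSum : ∀ j (p : Fun n) w → sum (λ b → del b (subwordSum j p) w) ≡ (len w - + j) * subwordSum j p w
sum-del-subwordSum zero    p []      = sum-zero {f = λ b → del b (subwordSum zero p) []} λ b → refl
sum-del-subwordSum {n} (suc j) p []  = trans (sum-replicate-zero n) (sym (*-zeroʳ (len {n} [] - + suc j)))
sum-del-subwordSum zero    p (x ∷ w) = trans (sum-del-∷ (subwordSum zero p) x w)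
  (trans (cong (_+_ (p [])) (sum-del-subwordSum zero p w)) (lemma (p []) (len w)))
  where
  lemma : ∀ q l → q + (l - 0ℤ) * q ≡ (1ℤ + l - 0ℤ) * q
  lemma = solve-∀
sum-del-subwordSum (suc j) p (x ∷ w) = begin
  sum (λ b → del b (subwordSum (suc j) p) (x ∷ w))
    ≡⟨ sum-del-∷ (subwordSum (suc j) p) x w ⟩
  subwordSum (suc j) p w + sum (λ b → del b (λ v → subwordSum (suc j) p v + subwordSum j (p ∘ (x ∷_)) v) w)
    ≡⟨ cong (_+_ (subwordSum (suc j) p w)) (trans
         (sum-cong-≗ λ b → del-add b (subwordSum (suc j) p) (subwordSum j (p ∘ (x ∷_))) w)
         (∑-distrib-+ (λ b → del b (subwordSum (suc j) p) w) _)) ⟩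
  subwordSum (suc j) p w + (sum (λ b → del b (subwordSum (suc j) p) w) + sum (λ b → del b (subwordSum j (p ∘ (x ∷_))) w))
    ≡⟨ cong₂ (λ y z → subwordSum (suc j) p w + (y + z)) (sum-del-subwordSum (suc j) p w) (sum-del-subwordSum j (p ∘ (x ∷_)) w) ⟩
  subwordSum (suc j) p w + ((len w - + suc j) * subwordSum (suc j) p w + (len w - + j) * subwordSum j (p ∘ (x ∷_)) w)
    ≡⟨ lemma (len w) (+ j) (subwordSum (suc j) p w) (subwordSum j (p ∘ (x ∷_)) w) ⟩
  (len (x ∷ w) - + suc j) * subwordSum (suc j) p (x ∷ w) ∎
  where
  open ≡-Reasoning
  lemma : ∀ l j p q → p + ((l - (1ℤ + j)) * p + (l - j) * q) ≡ (1ℤ + l - (1ℤ + j)) * (p + q)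
  lemma = solve-∀

Unique-resp-↭ : ∀ {v w : Word n} → v ↭ w → Unique v → Unique w
Unique-resp-↭ p = ↭ₛ.Unique-resp-↭ (setoid _) (↭⇒↭ₛ p)

-- Removing `b` from a word without repetitions leaves rearrangements that lack `b`, where `ins-σ`
-- lets `ins b σ` be replaced by `σ`. So each stage only sums over deletions, and
-- `sum-del-subwordSum` supplies the factor `len w - j`, which is `suc k`: the next factor of the
-- factorial.
T-σ : ∀ k j (w : Word n) → Unique w → k ℕ.+ j ≡ length w → T k σ w ≡ + (k !) * subwordSum j σ w
T-σ zero    j w _  refl = trans (sym (subwordSum-length σ w)) (sym (*-identityˡ _))
T-σ {n} (suc k) j w w! eq = begin
  sum (λ b → del b (T k (ins b σ)) w)
    ≡⟨ sum-cong-≗ (λ b → trans (del-cong b {w = w} (removed b)) (del-scale b (+ (k !)) (subwordSum j σ) w)) ⟩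
  sum (λ b → + (k !) * del b (subwordSum j σ) w)
    ≡⟨ sym (*-distribˡ-sum (+ (k !)) λ b → del b (subwordSum j σ) w) ⟩
  + (k !) * sum (λ b → del b (subwordSum j σ) w)
    ≡⟨ cong (+ (k !) *_) (sum-del-subwordSum j σ w) ⟩
  + (k !) * ((len w - + j) * subwordSum j σ w)
    ≡⟨ cong (λ l → + (k !) * ((+ l - + j) * subwordSum j σ w)) (sym eq) ⟩
  + (k !) * ((+ suc k + + j - + j) * subwordSum j σ w)
    ≡⟨ regroup (+ (k !)) (+ suc k) (+ j) (subwordSum j σ w) ⟩
  + suc k * + (k !) * subwordSum j σ w
    ≡⟨ cong (_* subwordSum j σ w) (sym (pos-* (suc k) (k !))) ⟩
  + (suc k !) * subwordSum j σ w ∎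
  where
  open ≡-Reasoning
  regroup : ∀ f k j q → f * ((k + j - j) * q) ≡ k * f * q
  regroup = solve-∀
  removed : ∀ b {v} → Removal b w v → T k (ins b σ) v ≡ + (k !) * subwordSum j σ v
  removed b {v} r with Unique-resp-↭ (removal-↭ r) w!
  ... | b∉v ∷ v! = trans
    (T-cong k λ {u} p → ins-σ b u (All-resp-↭ (↭-sym p) b∉v))
    (T-σ k j v v! (ℕₚ.suc-injective (trans eq (↭-length (removal-↭ r)))))

-- Relabelling letters by a permutation

module _ (π : Permutation′ n) where
  relabel : Word n → Word n
  relabel = map (π ⟨$⟩ʳ_)

  π-injective : ∀ {x y} → π ⟨$⟩ʳ x ≡ π ⟨$⟩ʳ y → x ≡ y
  π-injective eq = trans (sym (inverseˡ π)) (trans (cong (π ⟨$⟩ˡ_) eq) (inverseˡ π))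

  ins-relabel : ∀ a f w → ins a (f ∘ relabel) w ≡ ins (π ⟨$⟩ʳ a) f (relabel w)
  ins-relabel a f []      = refl
  ins-relabel a f (x ∷ w) = cong (_+_ (f (relabel (a ∷ x ∷ w)))) (ins-relabel a (f ∘ ((π ⟨$⟩ʳ x) ∷_)) w)

  del-relabel : ∀ b f w → del b (f ∘ relabel) w ≡ del (π ⟨$⟩ʳ b) f (relabel w)
  del-relabel b f []      = refl
  del-relabel b f (x ∷ w) = cong₂ (λ d r → d * f (relabel w) + r)
    (χ-⇔ (x ≟ b) (π ⟨$⟩ʳ x ≟ π ⟨$⟩ʳ b) (cong (π ⟨$⟩ʳ_)) π-injective)
    (del-relabel b (f ∘ ((π ⟨$⟩ʳ x) ∷_)) w)

  -- Relabelling merely permutes the letters `b` that `T` sums over.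
  T-relabel : ∀ k f w → T k (f ∘ relabel) w ≡ T k f (relabel w)
  T-relabel zero    f w = refl
  T-relabel (suc k) f w = trans
    (sum-cong-≗ λ b → trans
      (del-resp b (λ v → trans (resp (T-linear k) (ins-relabel b f) v) (T-relabel k (ins (π ⟨$⟩ʳ b) f) v)) w)
      (del-relabel b (T k (ins (π ⟨$⟩ʳ b) f)) w))
    (sym (∑-permute (λ b → del b (T k (ins b f)) (relabel w)) π))

  total-relabel : ∀ m f → total m (f ∘ relabel) ≡ total m f
  total-relabel zero    f = refl
  total-relabel (suc m) f = trans
    (sum-cong-≗ λ x → total-relabel m (f ∘ ((π ⟨$⟩ʳ x) ∷_)))
    (sym (∑-permute (λ x → total m (f ∘ (x ∷_))) π))

-- From words to permutations

total-punchIn : ∀ m (j : Fin (suc n)) f → (∀ w → ¬ All (j ≢_) w → f w ≡ 0ℤ) →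
  total m f ≡ total m (f ∘ map (punchIn j))
total-punchIn zero    j f vanish = refl
total-punchIn (suc m) j f vanish = begin
  sum (λ x → total m (f ∘ (x ∷_)))
    ≡⟨ sum-remove {i = j} (λ x → total m (f ∘ (x ∷_))) ⟩
  total m (f ∘ (j ∷_)) + sum (λ y → total m (f ∘ (punchIn j y ∷_)))
    ≡⟨ cong₂ _+_ (total-zero m λ w _ → vanish (j ∷ w) λ { (j≢j ∷ _) → j≢j refl })
         (sum-cong-≗ λ y → total-punchIn m j (f ∘ (punchIn j y ∷_)) λ w j∈w → vanish _ (λ { (_ ∷ j∉w) → j∈w j∉w })) ⟩
  0ℤ + sum (λ y → total m (f ∘ (punchIn j y ∷_) ∘ map (punchIn j)))
    ≡⟨ +-identityˡ _ ⟩
  total (suc m) (f ∘ map (punchIn j)) ∎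
  where open ≡-Reasoning

-- Shaped so that `sumPerms n f` unfolds to `listSum f (allPerms n)`.
listSum : ∀ {A : Set} → (A → ℤ) → List A → ℤ
listSum f xs = foldr _+_ (+ 0) (map f xs)

listSum-++ : ∀ {A : Set} (f : A → ℤ) xs ys → listSum f (xs ++ ys) ≡ listSum f xs + listSum f ys
listSum-++ f []       ys = sym (+-identityˡ _)
listSum-++ f (x ∷ xs) ys = trans (cong (_+_ (f x)) (listSum-++ f xs ys)) (sym (+-assoc (f x) _ _))

listSum-map : ∀ {A B : Set} (f : B → ℤ) (g : A → B) xs → listSum f (map g xs) ≡ listSum (f ∘ g) xs
listSum-map f g xs = cong (foldr _+_ (+ 0)) (sym (map-∘ xs))

listSum-cong : ∀ {A : Set} {f g : A → ℤ} → f ≗ g → listSum f ≗ listSum g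
listSum-cong h xs = cong (foldr _+_ (+ 0)) (map-cong h xs)

listSum-scale : ∀ {A : Set} c (f : A → ℤ) xs → listSum (λ x → c * f x) xs ≡ c * listSum f xs
listSum-scale c f []       = sym (*-zeroʳ c)
listSum-scale c f (x ∷ xs) = trans (cong (_+_ (c * f x)) (listSum-scale c f xs)) (sym (*-distribˡ-+ c (f x) _))

listSum-concatMap : ∀ {A : Set} {m i} (f : A → ℤ) (g : Fin m → List A) (h : Fin i → Fin m) →
  listSum f (concatMap g (toList (Vec.tabulate h))) ≡ sum λ x → listSum f (g (h x))
listSum-concatMap {i = zero}  f g h = refl
listSum-concatMap {i = suc _} f g h = trans (listSum-++ f (g (h zero)) _)
  (cong (_+_ (listSum f (g (h zero)))) (listSum-concatMap f g (h ∘ suc)))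

word : Permutation′ n → Word n
word w = tabulate (w ⟨$⟩ʳ_)

-- After a head `j`, the tail of a repetition-free word avoids `j`, hence comes through `punchIn j`
-- from a smaller alphabet. This is how `insert zero j` builds permutations.
total-allPerms : ∀ n (f : Fun n) → (∀ w → ¬ Unique w → f w ≡ 0ℤ) →
  total n f ≡ sumPerms n (f ∘ word)
total-allPerms zero    f vanish = sym (+-identityʳ (f []))
total-allPerms (suc n) f vanish = begin
  sum (λ j → total n (f ∘ (j ∷_)))
    ≡⟨ sum-cong-≗ (λ j → begin
         total n (f ∘ (j ∷_))
           ≡⟨ total-punchIn n j (f ∘ (j ∷_)) (λ w j∈w → vanish (j ∷ w) λ { (j∉w ∷ _) → j∈w j∉w }) ⟩
         total n (f ∘ (j ∷_) ∘ map (punchIn j))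
           ≡⟨ total-allPerms n (f ∘ (j ∷_) ∘ map (punchIn j))
                (λ w ¬w! → vanish _ λ { (_ ∷ w!) → ¬w! (Uniqueₚ.map⁻ w!) }) ⟩
         listSum (f ∘ (j ∷_) ∘ map (punchIn j) ∘ word) (allPerms n)
           ≡⟨ listSum-cong (λ π → cong (f ∘ (j ∷_)) (map-tabulate (π ⟨$⟩ʳ_) (punchIn j))) (allPerms n) ⟩
         listSum (f ∘ word ∘ insert zero j) (allPerms n)
           ≡⟨ sym (listSum-map (f ∘ word) (insert zero j) (allPerms n)) ⟩
         listSum (f ∘ word) (map (insert zero j) (allPerms n)) ∎) ⟩
  sum (λ j → listSum (f ∘ word) (map (insert zero j) (allPerms n)))
    ≡⟨ sym (listSum-concatMap (f ∘ word) (λ j → map (insert zero j) (allPerms n)) (λ i → i)) ⟩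
  sumPerms (suc n) (f ∘ word) ∎
  where open ≡-Reasoning

-- Each step raises the letter by at least one. In `total-σ` this excludes every nonzero head.
increasing-bound : ∀ (x : Fin n) w → AllPairs Fin._<_ (x ∷ w) → Fin.toℕ x ℕ.+ length (x ∷ w) ≤ n
increasing-bound {n} x []      _ = subst (ℕ._≤ n) (ℕₚ.+-comm 1 (Fin.toℕ x)) (toℕ<n x)
increasing-bound {n} x (y ∷ w) ((x<y ∷ _) ∷ w↑) = ℕₚ.≤-trans
  (subst (ℕ._≤ Fin.toℕ y ℕ.+ length (y ∷ w)) (sym (ℕₚ.+-suc (Fin.toℕ x) (length (y ∷ w))))
    (ℕₚ.+-monoˡ-≤ (length (y ∷ w)) x<y))
  (increasing-bound y w w↑)

-- An increasing word as long as its alphabet must start with `zero`, and its tail, shifted down by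
-- one, is again such a word.
total-σ : ∀ n (f : Fun n) → total n (λ w → f w * σ w) ≡ f (tabulate λ i → i)
total-σ zero    f = lemma (f [])
  where
  lemma : ∀ p → p * 1ℤ ≡ p
  lemma = solve-∀
total-σ (suc n) f = begin
  total n (λ w → f (zero ∷ w) * σ (zero ∷ w)) + sum (λ y → total n λ w → f (suc y ∷ w) * σ (suc y ∷ w))
    ≡⟨ cong₂ _+_
         (trans (total-punchIn n zero (λ w → f (zero ∷ w) * σ (zero ∷ w)) containing-zero)
           (total-cong n λ w _ → cong (f (zero ∷ map suc w) *_) (σ-zero-∷ w)))
         (sum-zero λ y → total-zero n λ w eq → trans
           (cong (f (suc y ∷ w) *_) (χ-no (allPairs? _<?_ (suc y ∷ w)) λ w↑ → too-long y w eq (increasing-bound (suc y) w w↑)))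
           (*-zeroʳ (f (suc y ∷ w)))) ⟩
  total n (λ w → f (zero ∷ map suc w) * σ w) + 0ℤ
    ≡⟨ +-identityʳ _ ⟩
  total n (λ w → f (zero ∷ map suc w) * σ w)
    ≡⟨ total-σ n (λ w → f (zero ∷ map suc w)) ⟩
  f (zero ∷ map suc (tabulate λ i → i))
    ≡⟨ cong (f ∘ (zero ∷_)) (map-tabulate (λ i → i) suc) ⟩
  f (tabulate λ i → i) ∎
  where
  open ≡-Reasoning
  containing-zero : ∀ w → ¬ All (zero ≢_) w → f (zero ∷ w) * σ (zero ∷ w) ≡ 0ℤ
  containing-zero w 0∈w = trans
    (cong (f (zero ∷ w) *_) (χ-no (allPairs? _<?_ (zero ∷ w)) λ { (0<w ∷ _) → 0∈w (All.map <⇒≢ 0<w) }))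
    (*-zeroʳ (f (zero ∷ w)))
  σ-zero-∷ : ∀ w → σ (zero ∷ map suc w) ≡ σ w
  σ-zero-∷ w = χ-⇔ (allPairs? _<?_ (zero ∷ map suc w)) (allPairs? _<?_ w)
    (λ { (_ ∷ w↑) → AllPairs.map s<s⁻¹ (AllPairsₚ.map⁻ w↑) })
    (λ w↑ → Allₚ.map⁺ (All.universal (λ _ → z<s) w) ∷ AllPairsₚ.map⁺ (AllPairs.map s<s w↑))
  too-long : ∀ (y : Fin n) w → length w ≡ n → ¬ (suc (Fin.toℕ y) ℕ.+ suc (length w) ≤ suc n)
  too-long y w eq bound = ℕₚ.<-irrefl eq (ℕₚ.≤-trans (ℕₚ.m≤n+m _ (Fin.toℕ y)) (ℕ.s≤s⁻¹ bound))

-- Noninversions as sums over subwords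

pick : ∀ {m} → (Fin n → Fin m) → Subset n → Word m
pick g s = map g (elems s)

filter-suc : ∀ b (s : Subset n) xs →
  filter (λ i → i ∈? (b Vec.∷ s)) (map suc xs) ≡ map suc (filter (λ i → i ∈? s) xs)
filter-suc b s []       = refl
filter-suc b s (x ∷ xs) with does (x ∈? s)
... | true  = cong (suc x ∷_) (filter-suc b s xs)
... | false = filter-suc b s xs

toList-tabulate : ∀ {A : Set} {i} (h : Fin i → A) → toList (Vec.tabulate h) ≡ tabulate h
toList-tabulate {i = zero}  h = refl
toList-tabulate {i = suc _} h = cong (h zero ∷_) (toList-tabulate (h ∘ suc))

elems-tail : ∀ b (s : Subset n) →
  filter (λ i → i ∈? (b Vec.∷ s)) (toList (Vec.tabulate suc)) ≡ map suc (elems s)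
elems-tail b s = begin
  filter (λ i → i ∈? (b Vec.∷ s)) (toList (Vec.tabulate suc))
    ≡⟨ cong (filter (λ i → i ∈? (b Vec.∷ s))) (trans (toList-tabulate suc)
         (trans (sym (map-tabulate (λ i → i) suc)) (cong (map suc) (sym (toList-tabulate λ i → i))))) ⟩
  filter (λ i → i ∈? (b Vec.∷ s)) (map suc (toList (Vec.allFin _)))
    ≡⟨ filter-suc b s (toList (Vec.allFin _)) ⟩
  map suc (elems s) ∎
  where open ≡-Reasoning

elems-false : ∀ (s : Subset n) → elems (false Vec.∷ s) ≡ map suc (elems s)
elems-false s = elems-tail false s

elems-true : ∀ (s : Subset n) → elems (true Vec.∷ s) ≡ zero ∷ map suc (elems s)
elems-true s = cong (zero ∷_) (elems-tail true s)

elems-sorted : ∀ (s : Subset n) → AllPairs Fin._<_ (elems s)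
elems-sorted Vec.[]            = []
elems-sorted (false Vec.∷ s) rewrite elems-false s = AllPairsₚ.map⁺ (AllPairs.map s<s (elems-sorted s))
elems-sorted (true  Vec.∷ s) rewrite elems-true s  =
  Allₚ.map⁺ (All.universal (λ _ → z<s) (elems s)) ∷ AllPairsₚ.map⁺ (AllPairs.map s<s (elems-sorted s))

-- Skipping or keeping the first letter matches the `false` and `true` halves of `allSubsets`. The
-- map `g` is arbitrary because the induction shifts it to `g ∘ suc`.
subwordSum-subsets : ∀ {m} k (p : Fun m) (g : Fin n → Fin m) → subwordSum k p (tabulate g) ≡
  listSum (λ s → χ (∣ s ∣ ℕₚ.≟ k) * p (pick g s)) (allSubsets n)
subwordSum-subsets {zero}  zero    p g = lemma (p [])
  where
  lemma : ∀ q → q ≡ 1ℤ * q + 0ℤ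
  lemma = solve-∀
subwordSum-subsets {zero}  (suc k) p g = refl
subwordSum-subsets {suc n} k p g = begin
  subwordSum k p (tabulate g)
    ≡⟨ split k ⟩
  listSum (φ k ∘ (false Vec.∷_)) (allSubsets n) + listSum (φ k ∘ (true Vec.∷_)) (allSubsets n)
    ≡⟨ sym (cong₂ _+_ (listSum-map (φ k) (false Vec.∷_) (allSubsets n)) (listSum-map (φ k) (true Vec.∷_) (allSubsets n))) ⟩
  listSum (φ k) (map (false Vec.∷_) (allSubsets n)) + listSum (φ k) (map (true Vec.∷_) (allSubsets n))
    ≡⟨ sym (listSum-++ (φ k) (map (false Vec.∷_) (allSubsets n)) _) ⟩
  listSum (φ k) (allSubsets (suc n)) ∎
  where
  open ≡-Reasoning
  φ : ℕ → Subset (suc n) → ℤ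
  φ k s = χ (∣ s ∣ ℕₚ.≟ k) * p (pick g s)

  pick-false : ∀ s → pick g (false Vec.∷ s) ≡ pick (g ∘ suc) s
  pick-false s = trans (cong (map g) (elems-false s)) (sym (map-∘ (elems s)))

  pick-true : ∀ s → pick g (true Vec.∷ s) ≡ g zero ∷ pick (g ∘ suc) s
  pick-true s = trans (cong (map g) (elems-true s)) (cong (g zero ∷_) (sym (map-∘ (elems s))))

  without : ∀ k → subwordSum k p (tabulate (g ∘ suc)) ≡ listSum (φ k ∘ (false Vec.∷_)) (allSubsets n)
  without k = trans (subwordSum-subsets k p (g ∘ suc))
    (listSum-cong (λ s → cong (λ v → χ (∣ s ∣ ℕₚ.≟ k) * p v) (sym (pick-false s))) (allSubsets n))

  split : ∀ k → subwordSum k p (tabulate g) ≡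
    listSum (φ k ∘ (false Vec.∷_)) (allSubsets n) + listSum (φ k ∘ (true Vec.∷_)) (allSubsets n)
  -- A subset containing the first position is nonempty, so its indicator of size zero computes to
  -- `0ℤ` and the second sum vanishes.
  split zero = trans (sym (+-identityʳ (p []))) (cong₂ _+_ (without zero)
    (sym (trans (listSum-scale 0ℤ (λ s → p (pick g (true Vec.∷ s))) (allSubsets n)) refl)))
  split (suc k) = cong₂ _+_ (without (suc k)) (trans (subwordSum-subsets k (p ∘ (g zero ∷_)) (g ∘ suc))
    (listSum-cong (λ s → cong₂ _*_
      (χ-⇔ (∣ s ∣ ℕₚ.≟ k) (suc ∣ s ∣ ℕₚ.≟ suc k) (cong suc) ℕₚ.suc-injective)
      (cong p (sym (pick-true s)))) (allSubsets n)))

length-filter : ∀ {A : Set} {P : A → Set} (P? : ∀ x → Dec (P x)) xs →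
  + length (filter P? xs) ≡ listSum (λ x → χ (P? x)) xs
length-filter P? []       = refl
length-filter P? (x ∷ xs) with does (P? x)
... | true  = cong (_+_ 1ℤ) (length-filter P? xs)
... | false = trans (length-filter P? xs) (sym (+-identityˡ _))

All-All⁺ : ∀ {A : Set} {R : A → A → Set} {xs} →
  AllPairs (λ x y → R x y) xs → AllPairs (λ x y → R y x) xs → All (λ x → R x x) xs →
  All (λ x → All (R x) xs) xs
All-All⁺ []         []         []         = []
All-All⁺ (h ∷ hs) (h′ ∷ hs′) (r ∷ rs) = (r ∷ h) ∷ All.zipWith (uncurry _∷_) (h′ , All-All⁺ hs hs′ rs)

All-All⁻ : ∀ {A : Set} {R : A → A → Set} {xs} → All (λ x → All (R x) xs) xs → AllPairs R xs
All-All⁻ []               = []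
All-All⁻ ((_ ∷ h) ∷ hs) = h ∷ All-All⁻ (All.map All.tail hs)

IncreasingOn⇒ : ∀ (w : Permutation′ n) s → IncreasingOn w s → AllPairs Fin._<_ (pick (w ⟨$⟩ʳ_) s)
IncreasingOn⇒ w s inc = AllPairsₚ.map⁺
  (AllPairs.zipWith (λ { (i<j , f) → f i<j }) (elems-sorted s , All-All⁻ inc))

-- `IncreasingOn` ranges over all ordered pairs. As `elems s` is sorted, the premise `i < j` fails
-- on reversed and diagonal pairs, which therefore hold vacuously.
⇒IncreasingOn : ∀ (w : Permutation′ n) s → AllPairs Fin._<_ (pick (w ⟨$⟩ʳ_) s) → IncreasingOn w s
⇒IncreasingOn w s w↑ = All-All⁺
  (AllPairs.map (λ wi<wj _ → wi<wj) (AllPairsₚ.map⁻ w↑))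
  (AllPairs.map (λ i<j j<i → contradiction (<-trans i<j j<i) (<-irrefl refl)) (elems-sorted s))
  (All.universal (λ i i<i → contradiction i<i (<-irrefl refl)) (elems s))

noninv-subwordSum : ∀ k (w : Permutation′ n) → + noninv k w ≡ subwordSum k σ (word w)
noninv-subwordSum {n} k w = begin
  + noninv k w
    ≡⟨ length-filter (λ s → (∣ s ∣ ℕₚ.≟ k) ×-dec increasingOn? w s) (allSubsets n) ⟩
  listSum (λ s → χ ((∣ s ∣ ℕₚ.≟ k) ×-dec increasingOn? w s)) (allSubsets n)
    ≡⟨ listSum-cong (λ s → trans (χ-∧ (∣ s ∣ ℕₚ.≟ k) (increasingOn? w s))
         (cong (χ (∣ s ∣ ℕₚ.≟ k) *_)
           (χ-⇔ (increasingOn? w s) (allPairs? _<?_ (pick (w ⟨$⟩ʳ_) s)) (IncreasingOn⇒ w s) (⇒IncreasingOn w s))))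
         (allSubsets n) ⟩
  listSum (λ s → χ (∣ s ∣ ℕₚ.≟ k) * σ (pick (w ⟨$⟩ʳ_) s)) (allSubsets n)
    ≡⟨ sym (subwordSum-subsets k σ (w ⟨$⟩ʳ_)) ⟩
  subwordSum k σ (word w) ∎
  where open ≡-Reasoning

-- The matrices `ν` as matrices of the operators `T`

σ[_] : Permutation′ n → Fun n
σ[ u ] w = σ (relabel (flip u) w)

word-unique : ∀ (w : Permutation′ n) → Unique (word w)
word-unique w = Uniqueₚ.tabulate⁺ (π-injective w)

-- The last factor unfolds to `ν n j w u`, so `T k σ[ u ]` lists the column of `u`, scaled by `k !`.
-- Relabelling by the inverse of `u` reduces this to `T-σ`.
T-σ[] : ∀ k j → k ℕ.+ j ≡ n → ∀ (u w : Permutation′ n) →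
  T k σ[ u ] (word w) ≡ + (k !) * + noninv j (w ∘ₚ flip u)
T-σ[] k j eq u w = begin
  T k (σ ∘ relabel (flip u)) (word w)  ≡⟨ T-relabel (flip u) k σ (word w) ⟩
  T k σ (relabel (flip u) (word w))    ≡⟨ cong (T k σ) (map-tabulate (w ⟨$⟩ʳ_) (flip u ⟨$⟩ʳ_)) ⟩
  T k σ (word (w ∘ₚ flip u))
    ≡⟨ T-σ k j (word (w ∘ₚ flip u)) (word-unique (w ∘ₚ flip u)) (trans eq (sym (length-tabulate ((w ∘ₚ flip u) ⟨$⟩ʳ_)))) ⟩
  + (k !) * subwordSum j σ (word (w ∘ₚ flip u)) ≡⟨ cong (+ (k !) *_) (sym (noninv-subwordSum j (w ∘ₚ flip u))) ⟩
  + (k !) * + noninv j (w ∘ₚ flip u)   ∎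
  where open ≡-Reasoning

-- Rearranging or relabelling a word with a repeated letter keeps the repetition, so no increasing
-- word is reached.
T-σ[]-vanish : ∀ k (u : Permutation′ n) w → ¬ Unique w → T k σ[ u ] w ≡ 0ℤ
T-σ[]-vanish k u w ¬w! = trans
  (T-cong k {g = λ _ → 0ℤ} λ {v} p → χ-no (allPairs? _<?_ (relabel (flip u) v)) λ v↑ →
    ¬w! (Unique-resp-↭ p (Uniqueₚ.map⁻ (AllPairs.map <⇒≢ v↑))))
  (null (T-linear k) w)

-- Among the words of length n, only word u becomes increasing under u⁻¹.
⟨,σ[]⟩ : ∀ (f : Fun n) (u : Permutation′ n) → ⟨ f , σ[ u ] ⟩ n ≡ f (word u)
⟨,σ[]⟩ {n} f u = begin
  total n (λ w → f w * σ (relabel (flip u) w))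
    ≡⟨ total-cong n (λ w _ → cong (λ v → f v * σ (relabel (flip u) w)) (sym (restore w))) ⟩
  total n ((λ w → f (relabel u w) * σ w) ∘ relabel (flip u))
    ≡⟨ total-relabel (flip u) n (λ w → f (relabel u w) * σ w) ⟩
  total n (λ w → f (relabel u w) * σ w)
    ≡⟨ total-σ n (f ∘ relabel u) ⟩
  f (relabel u (tabulate λ i → i))
    ≡⟨ cong f (map-tabulate (λ i → i) (u ⟨$⟩ʳ_)) ⟩
  f (word u) ∎
  where
  open ≡-Reasoning
  restore : ∀ w → relabel u (relabel (flip u) w) ≡ w
  restore w = trans (sym (map-∘ w)) (trans (map-cong (λ i → inverseʳ u) w) (map-id w))

-- Self-adjointness tested on point masses; it amounts to the symmetry of `ν` and turns rows into
-- columns.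
T-σ[]-sym : ∀ k (u w : Permutation′ n) → T k σ[ w ] (word u) ≡ T k σ[ u ] (word w)
T-σ[]-sym {n} k u w = begin
  T k σ[ w ] (word u)        ≡⟨ sym (⟨,σ[]⟩ (T k σ[ w ]) u) ⟩
  ⟨ T k σ[ w ] , σ[ u ] ⟩ n  ≡⟨ T-adjoint n k σ[ w ] σ[ u ] ⟩
  ⟨ σ[ w ] , T k σ[ u ] ⟩ n  ≡⟨ ⟨⟩-comm n σ[ w ] (T k σ[ u ]) ⟩
  ⟨ T k σ[ u ] , σ[ w ] ⟩ n  ≡⟨ ⟨,σ[]⟩ (T k σ[ u ]) w ⟩
  T k σ[ u ] (word w)        ∎
  where open ≡-Reasoning

-- An entry of the product pairs a row of one matrix with a column of the other. By symmetry this is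
-- an inner product of two functions `T _ σ[ _ ]`, and self-adjointness moves `T a` across onto
-- `T b σ[ v ]`.
⊗-TT : ∀ a b k l → a ℕ.+ k ≡ n → b ℕ.+ l ≡ n → ∀ (u v : Permutation′ n) →
  + (a ! ℕ.* b !) * (ν n k ⊗ ν n l) u v ≡ T a (T b σ[ v ]) (word u)
⊗-TT {n} a b k l eqₖ eqₗ u v = begin
  + (a ! ℕ.* b !) * (ν n k ⊗ ν n l) u v
    ≡⟨ sym (listSum-scale (+ (a ! ℕ.* b !)) (λ w → ν n k u w * ν n l w v) (allPerms n)) ⟩
  listSum (λ w → + (a ! ℕ.* b !) * (ν n k u w * ν n l w v)) (allPerms n)
    ≡⟨ listSum-cong entry (allPerms n) ⟩
  listSum (λ w → T a σ[ u ] (word w) * T b σ[ v ] (word w)) (allPerms n)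
    -- The sum over permutations extends to all words of length `n`, since words with repetitions
    -- contribute zero.
    ≡⟨ sym (total-allPerms n (λ w → T a σ[ u ] w * T b σ[ v ] w)
         λ w ¬w! → cong (_* T b σ[ v ] w) (T-σ[]-vanish a u w ¬w!)) ⟩
  ⟨ T a σ[ u ] , T b σ[ v ] ⟩ n
    ≡⟨ T-adjoint n a σ[ u ] (T b σ[ v ]) ⟩
  ⟨ σ[ u ] , T a (T b σ[ v ]) ⟩ n
    ≡⟨ ⟨⟩-comm n σ[ u ] (T a (T b σ[ v ])) ⟩
  ⟨ T a (T b σ[ v ]) , σ[ u ] ⟩ n
    ≡⟨ ⟨,σ[]⟩ (T a (T b σ[ v ])) u ⟩
  T a (T b σ[ v ]) (word u) ∎
  where
  open ≡-Reasoning
  regroup : ∀ x y p q → x * y * (p * q) ≡ x * p * (y * q)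
  regroup = solve-∀
  entry : ∀ w → + (a ! ℕ.* b !) * (ν n k u w * ν n l w v) ≡ T a σ[ u ] (word w) * T b σ[ v ] (word w)
  entry w = begin
    + (a ! ℕ.* b !) * (ν n k u w * ν n l w v)
      ≡⟨ cong (_* (ν n k u w * ν n l w v)) (pos-* (a !) (b !)) ⟩
    + (a !) * + (b !) * (ν n k u w * ν n l w v)
      ≡⟨ regroup (+ (a !)) (+ (b !)) (ν n k u w) (ν n l w v) ⟩
    + (a !) * ν n k u w * (+ (b !) * ν n l w v)
      ≡⟨ sym (cong₂ _*_ (T-σ[] a k eqₖ w u) (T-σ[] b l eqₗ v w)) ⟩
    T a σ[ w ] (word u) * T b σ[ v ] (word w)
      ≡⟨ cong (_* T b σ[ v ] (word w)) (T-σ[]-sym a u w) ⟩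
    T a σ[ u ] (word w) * T b σ[ v ] (word w) ∎

theorem1p1 : (n : ℕ) → 1 ≤ n → (k ℓ : ℕ) → 1 ≤ k → k ≤ n → 1 ≤ ℓ → ℓ ≤ n →
    (u v : Permutation′ n) → (ν n k ⊗ ν n ℓ) u v ≡ (ν n ℓ ⊗ ν n k) u v
-- The operators see `ν` only up to factorials: `n ∸ k` and `n ∸ ℓ` letters are moved. The nonzero
-- product `c` of the two factorials is cancelled in ℤ.
theorem1p1 n _ k ℓ _ k≤n _ ℓ≤n u v = *-cancelˡ-≡ c _ _ {{a !* b !≢0}} (begin
  c * (ν n k ⊗ ν n ℓ) u v
    ≡⟨ ⊗-TT a b k ℓ (ℕₚ.m∸n+n≡m k≤n) (ℕₚ.m∸n+n≡m ℓ≤n) u v ⟩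
  T a (T b σ[ v ]) (word u)
    ≡⟨ T-comm n a b σ[ v ] (word u) (length-tabulate (u ⟨$⟩ʳ_)) ⟩
  T b (T a σ[ v ]) (word u)
    ≡⟨ sym (⊗-TT b a ℓ k (ℕₚ.m∸n+n≡m ℓ≤n) (ℕₚ.m∸n+n≡m k≤n) u v) ⟩
  + (b ! ℕ.* a !) * (ν n ℓ ⊗ ν n k) u v
    ≡⟨ cong (λ x → + x * (ν n ℓ ⊗ ν n k) u v) (ℕₚ.*-comm (b !) (a !)) ⟩
  c * (ν n ℓ ⊗ ν n k) u v ∎)
  where
  open ≡-Reasoning
  a b : ℕ
  a = n ℕ.∸ k
  b = n ℕ.∸ ℓ
  c : ℤ
  c = + (a ! ℕ.* b !)
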